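{- Every two-player stochastic game (with perfect information) of type $a\in\mathbb N^n$, with $m=\sum_{j}a_j$ actions in total, admits a formulation as a P-GLCP$(\mathbf SMS,\mathbf Sq)$, where $M\in\mathbb R^{(m-n)\times n}$ is a hidden K-matrix of type $a-\mathbf 1$, $S$ is an $n\times n$ signature matrix, and $q$ is some vector in $\mathbb R^{m-n}$.
   Context: Write $[n]=\{1,\dots,n\}$; $\mathbf 1$ is the all-ones vector. A block matrix of type $b=(b_1,\dots,b_n)$ is a real matrix with $n$ columns whose rows are partitioned into $n$ consecutive blocks, block $j$ having $b_j$ rows; rows are indexed by $N(b)=\{(j,i): j\in[n], i\in[b_j]\}$. $B\subseteq N(b)$ is maximal complementary if it contains exactly one $(j,i)$ for each $j$; then the $n\times n$ matrix $M_B$ of rows in $B$ is a representative submatrix. A square matrix is a P-matrix if all its principal minors are positive, a Z-matrix if its off-diagonal entries are nonpositive; a block matrix is a P-matrix (Z-matrix) if every representative submatrix is. A block matrix $M$ of type $b$ is a hidden Z-matrix if there are a square Z-matrix $X\in\mathbb R^{n\times n}$, a block Z-matrix $Y$ of type $b$, and vectors $r,s\ge\mathbf 0$ with $MX=Y$ and $X^Tr+Y^Ts>\mathbf 0$; it is a hidden K-matrix if it is moreover a P-matrix. A signature matrix $S$ is a diagonal matrix with diagonal entries $s_{jj}\in\{ -1,1\}$; $\mathbf S$ is the block diagonal matrix with $n$ blocks, the $j$-th block being $s_{jj}I$ of the size of block $j$ of $M$. GLCP$(M,q)$ of type $b$: find $z\in\mathbb R^n$ and a block vector $w$ of type $b$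 with $w-Mz=q$, $w,z\ge\mathbf 0$, $z_j\prod_{i=1}^{b_j}w^j_i=0$ for all $j\in[n]$. A P-GLCP is a GLCP whose matrix is a block P-matrix. Two-player stochastic game of type $a=(a_1,\dots,a_n)$: $n$ states partitioned as $[n]=S_{\max}\cup S_{\min}$; state $j$ has actions $i\in[a_j]$ with rewards $r^j_i\in\mathbb R$ and transition probabilities $p^j_{ik}\ge0$, $\sum_kp^j_{ik}=1$; discount factor $\gamma\in[0,1)$. Its values are the unique $v\in\mathbb R^n$ with $v_j=\max_{i\in[a_j]}\{r^j_i+\gamma\sum_kp^j_{ik}v_k\}$ for $j\in S_{\max}$ and $v_j=\min_{i\in[a_j]}\{r^j_i+\gamma\sum_kp^j_{ik}v_k\}$ for $j\in S_{\min}$. A policy $\pi$ (with $\pi(j)\in[a_j]$ for each $j$) is optimal if for each $j$ the action $\pi(j)$ attains the max resp. min. A GLCP of type $a-\mathbf 1$ is a formulation of the game if its solution $(w,z)$ encodes the optimal policies: setting $u^j_i=w^j_i$ for $i\in[a_j-1]$ and $u^j_{a_j}=z_j$, a policy $\pi$ is optimal if and only if $u^j_{\pi(j)}=0$ for all $j\in[n]$. -}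

module Defs where

open import Algebra.Bundles using (CommutativeRing; Semiring)
import Algebra.Definitions.RawMonoid as RawMonoidDefinitions
import Algebra.Definitions.RawSemiring as RawSemiringDefinitions
open import Data.Bool.Base using (if_then_else_)
open import Data.Fin.Base using (Fin; zero; suc; toℕ; fromℕ; _<_)
open import Data.Fin.Properties using (_≟_)
open import Data.Nat.Base using (ℕ; zero; suc; pred; NonZero)
open import Data.Product.Base using (Σ-syntax; ∃-syntax; _×_)
open import Data.Sum.Base using (_⊎_)
open import Data.Vec.Functional using (Vector; insertAt; removeAt)
open import Function.Base using (_∘_)
open import Function.Bundles using (_⇔_)
open import Level using (0ℓ)
open import Relation.Binary.Core using (Rel)
open import Relation.Binary.Structures using (IsDecTotalOrder)
import Relation.Binary.Construct.NonStrictToStrict as ToStrict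
open import Relation.Binary.PropositionalEquality.Core using (_≢_)
open import Relation.Nullary.Decidable.Core using (does)

-- The classical real numbers, axiomatised as the Dedekind-complete ordered
-- field (classically unique up to isomorphism).  The decidable order is the
-- classical trichotomy.

record Reals : Set₁ where
  field
    commutativeRing : CommutativeRing 0ℓ 0ℓ
  open CommutativeRing commutativeRing public

  infix 4 _≤_
  field
    _≤_             : Rel Carrier 0ℓ
    isDecTotalOrder : IsDecTotalOrder _≈_ _≤_
    0≉1             : 0# ≉ 1#
    inverse         : ∀ x → x ≉ 0# → ∃[ y ] x * y ≈ 1#
    +-monoʳ-≤       : ∀ x {y z} → y ≤ z → x + y ≤ x + z
    *-nonNegative   : ∀ {x y} → 0# ≤ x → 0# ≤ y → 0# ≤ x * y

  IsUpperBound : (Carrier → Set) → Carrier → Set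
  IsUpperBound P b = ∀ x → P x → x ≤ b

  field
    complete : ∀ (P : Carrier → Set) → ∃[ x ] P x → ∃[ b ] IsUpperBound P b →
               ∃[ s ] (IsUpperBound P s × (∀ b → IsUpperBound P b → s ≤ b))

  open ToStrict _≈_ _≤_ public using () renaming (_<_ to _<ᴿ_)

module Theory (ℝ : Reals) where

  open Reals ℝ hiding (zero)
  open RawMonoidDefinitions +-rawMonoid using (sum)
  open RawMonoidDefinitions *-rawMonoid using () renaming (sum to product)
  open RawSemiringDefinitions (Semiring.rawSemiring semiring) using (_^_)

  Vec : ℕ → Set
  Vec = Vector Carrier

  Matrix : ℕ → ℕ → Set
  Matrix m n = Vector (Vec n) m

  BlockVec : ∀ {n} → (Fin n → ℕ) → Set
  BlockVec b = ∀ j → Vec (b j)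

  -- There are as many blocks as columns, so n is determined by the type b.
  BlockMatrix : ∀ {n} → (Fin n → ℕ) → Set
  BlockMatrix {n} b = ∀ j → Matrix (b j) n

  infixl 7 _·_ _·ᵛ_

  _·_ : ∀ {l m n} → Matrix l m → Matrix m n → Matrix l n
  (A · B) i k = sum λ j → A i j * B j k

  _·ᵛ_ : ∀ {m n} → Matrix m n → Vec n → Vec m
  (A ·ᵛ x) i = sum λ j → A i j * x j

  scalarMatrix : ∀ k → Carrier → Matrix k k
  scalarMatrix k c i j = if does (i ≟ j) then c else 0#

  -- Laplace expansion along the first row.
  det : ∀ {n} → Matrix n n → Carrier
  det {zero}  A = 1#
  det {suc n} A =
    sum λ j → (- 1#) ^ toℕ j * (A zero j * det (λ i → removeAt (A (suc i)) j))

  -- A principal submatrix is given by the increasing enumeration of its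
  -- index set.  (The empty one has determinant 1, hence is harmless.)
  IsPMatrix : ∀ {n} → Matrix n n → Set
  IsPMatrix {n} A =
    ∀ {k} (α : Fin k → Fin n) → (∀ {i j} → i < j → α i < α j) →
    0# <ᴿ det (λ i j → A (α i) (α j))

  IsZMatrix : ∀ {n} → Matrix n n → Set
  IsZMatrix A = ∀ i j → i ≢ j → A i j ≤ 0#

  -- A maximal complementary set contains exactly one row of each block, so it
  -- is the same thing as a function selecting that row.
  representative : ∀ {n} {b : Fin n → ℕ} →
                   BlockMatrix b → (∀ j → Fin (b j)) → Matrix n n
  representative M B j = M j (B j)

  IsBlockPMatrix : ∀ {n} {b : Fin n → ℕ} → BlockMatrix b → Set
  IsBlockPMatrix M = ∀ B → IsPMatrix (representative M B)

  IsBlockZMatrix : ∀ {n} {b : Fin n → ℕ} → BlockMatrix b → Set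
  IsBlockZMatrix M = ∀ B → IsZMatrix (representative M B)

  IsHiddenZMatrix : ∀ {n} {b : Fin n → ℕ} → BlockMatrix b → Set
  IsHiddenZMatrix {n} {b} M =
    Σ[ X ∈ Matrix n n ] Σ[ Y ∈ BlockMatrix b ] Σ[ r ∈ Vec n ] Σ[ s ∈ BlockVec b ]
      ( IsZMatrix X
      × IsBlockZMatrix Y
      × (∀ j → 0# ≤ r j)
      × (∀ j i → 0# ≤ s j i)
      × (∀ j i k → (M j · X) i k ≈ Y j i k)
      × (∀ k → 0# <ᴿ (sum λ j → X j k * r j)
                     + (sum λ j → sum λ i → Y j i k * s j i)))

  IsHiddenKMatrix : ∀ {n} {b : Fin n → ℕ} → BlockMatrix b → Set
  IsHiddenKMatrix M = IsHiddenZMatrix M × IsBlockPMatrix M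

  IsSignature : ∀ {n} → Matrix n n → Set
  IsSignature S = (∀ i j → i ≢ j → S i j ≈ 0#)
                × (∀ j → S j j ≈ 1# ⊎ S j j ≈ - 1#)

  -- The block diagonal matrix 𝐒, given by its diagonal blocks.  Being block
  -- diagonal, it multiplies block matrices and block vectors blockwise.
  𝐒[_] : ∀ {n} {b : Fin n → ℕ} → Matrix n n → ∀ j → Matrix (b j) (b j)
  𝐒[_] {b = b} S j = scalarMatrix (b j) (S j j)

  conjugate : ∀ {n} {b : Fin n → ℕ} → Matrix n n → BlockMatrix b → BlockMatrix b
  conjugate {b = b} S M j = 𝐒[_] {b = b} S j · M j · S

  signed : ∀ {n} {b : Fin n → ℕ} → Matrix n n → BlockVec b → BlockVec b
  signed {b = b} S q j = 𝐒[_] {b = b} S j ·ᵛ q j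

  record IsGLCPSolution {n} {b : Fin n → ℕ} (M : BlockMatrix b) (q : BlockVec b)
                        (w : BlockVec b) (z : Vec n) : Set where
    field
      equation      : ∀ j i → w j i - (M j ·ᵛ z) i ≈ q j i
      w-nonNegative : ∀ j i → 0# ≤ w j i
      z-nonNegative : ∀ j → 0# ≤ z j
      complementary : ∀ j → z j * product (w j) ≈ 0#

  data Player : Set where
    maxPlayer minPlayer : Player

  record Game {n} (a : Fin n → ℕ) : Set where
    field
      hasAction      : ∀ j → NonZero (a j)
      owner          : Fin n → Player
      reward         : BlockVec a
      transition     : BlockMatrix a
      transition≥0   : ∀ j i k → 0# ≤ transition j i k
      transition-sum : ∀ j i → sum (transition j i) ≈ 1#
      γ              : Carrier
      0≤γ            : 0# ≤ γ
      γ<1            : γ <ᴿ 1#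

    actionValue : Vec n → BlockVec a
    actionValue v j i = reward j i + γ * (transition j ·ᵛ v) i

    Policy : Set
    Policy = ∀ j → Fin (a j)

  IsOptimum : ∀ {k} → Player → Vec k → Carrier → Set
  IsOptimum maxPlayer f x = (∀ i → f i ≤ x) × (∃[ i ] x ≈ f i)
  IsOptimum minPlayer f x = (∀ i → x ≤ f i) × (∃[ i ] x ≈ f i)

  module _ {n} {a : Fin n → ℕ} (G : Game a) where

    open Game G

    IsValue : Vec n → Set
    IsValue v = ∀ j → IsOptimum (owner j) (actionValue v j) (v j)

    IsOptimalPolicy : Policy → Set
    IsOptimalPolicy π =
      Σ[ v ∈ Vec n ] (IsValue v × (∀ j → v j ≈ actionValue v j (π j)))

    -- The vector with entries w₁, …, w_{k-1}, z.
    append : ∀ {k} → .{{NonZero k}} → Vec (pred k) → Carrier → Vec k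
    append {suc k} w z = insertAt w (fromℕ k) z

    slack : BlockVec (pred ∘ a) → Vec n → BlockVec a
    slack w z j = append {{hasAction j}} (w j) (z j)

    -- Speaking of "its solution", the notion includes that there is exactly one.
    IsFormulation : BlockMatrix (pred ∘ a) → BlockVec (pred ∘ a) → Set
    IsFormulation M q =
      Σ[ w ∈ BlockVec (pred ∘ a) ] Σ[ z ∈ Vec n ]
        ( IsGLCPSolution M q w z
        × (∀ w′ z′ → IsGLCPSolution M q w′ z′ →
             (∀ j i → w′ j i ≈ w j i) × (∀ j → z′ j ≈ z j))
        × (∀ π → IsOptimalPolicy π ⇔ (∀ j → slack w z j (π j) ≈ 0#)))

{-# OPTIONS --safe #-}

-- Call the last action of each state its default action and let X = I − γP₀,
-- where P₀ collects the transitions of the default actions.  With S_jj = ±1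
-- according to the owner of j, the signed slacks S(v − r − γPv) of all actions
-- are nonnegative and complementary exactly when v is the value.  Taking the
-- slacks of the default actions as z gives v = X⁻¹(Sz + r₀), which turns the
-- slacks of the other actions into SMSz + Sq with M = YX⁻¹; here the rows of Y
-- are those of I − γP for the other actions, so MX = Y shows that M is hidden Z.
--
-- A matrix is a P-matrix if it reverses the sign of no nonzero vector: this
-- property passes to principal submatrices and Schur complements, and it forces
-- positive pivots.  A representative submatrix (I − γP)X⁻¹ has it, since at an
-- index where |y| is maximal (I − γP)y and Xy both have the sign of y.

module Submission where

open import Algebra.Bundles using (CommutativeRing)
import Algebra.Definitions.RawMonoid as RawMonoidDefinitions
open import Data.Fin.Base using (Fin; zero; suc; toℕ; fromℕ; punchIn; punchOut)
open import Data.Fin.Properties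
  using (_≟_; any?; <-cmp; <⇒≢; punchInᵢ≢i; punchIn-punchOut)
open import Data.List.Base as List using (List; []; _∷_; tabulate)
open import Data.List.Membership.Propositional using (_∈_)
open import Data.List.Properties using (map-tabulate)
open import Data.List.Relation.Unary.All as All using (All; []; _∷_)
import Data.List.Relation.Unary.All.Properties as All
open import Data.List.Relation.Unary.Any using (here; there)
open import Data.Nat.Base using (ℕ; zero; suc; pred; NonZero)
open import Data.Product.Base using (Σ-syntax; ∃-syntax; _×_; _,_; proj₁; proj₂)
open import Data.Sum.Base using (_⊎_; inj₁; inj₂; [_,_]′)
open import Data.Vec.Functional using (head; tail; removeAt)
open import Data.Vec.Functional.Properties using (insertAt-lookup; insertAt-punchIn)
open import Defs
open import Function.Base using (_∘_; const)
open import Function.Bundles using (_⇔_; mk⇔; module Equivalence)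
open import Level using (0ℓ)
open import Relation.Binary.Definitions using (tri<; tri≈; tri>)
open import Relation.Binary.PropositionalEquality using (_≡_; _≢_)
import Relation.Binary.PropositionalEquality as ≡
open import Relation.Binary.Structures using (IsDecTotalOrder)
open import Relation.Nullary using (¬_; yes; no; contradiction)

-- A ring solver with integer coefficients

module IntegerCoefficientSolver (R : CommutativeRing 0ℓ 0ℓ) where

  open import Algebra.Solver.Ring.AlmostCommutativeRing
    using (fromCommutativeRing; _-Raw-AlmostCommutative⟶_; Induced-equivalence)
  open import Data.Integer.Base as ℤ using (ℤ; +_; -[1+_]; _⊖_; _◃_)
  import Data.Integer.Properties as ℤ
  open import Data.Maybe.Base using (just; nothing)
  open import Data.Nat.Base as ℕ using ()
  import Data.Nat.Properties as ℕ
  import Data.Sign.Base as Sign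
  open import Relation.Binary.Definitions using (WeaklyDecidable)

  open CommutativeRing R
  open import Algebra.Properties.Ring ring
  open import Algebra.Properties.Semiring.Mult.TCOptimised semiring
    using (1+×; ×-homo-+; ×1-homo-*)
    renaming (_×_ to _×ᴿ_)
  open import Algebra.Properties.CommutativeSemigroup +-commutativeSemigroup
    using (interchange)
  open import Relation.Binary.Reasoning.Setoid setoid

  -- This form of the multiple makes `1 ×ᴿ 1#` reduce to `1#`, so that `:1` in a solver call denotes
  -- `1#` itself.
  fromℤ : ℤ → Carrier
  fromℤ (+ n)    = n ×ᴿ 1#
  fromℤ -[1+ n ] = - (ℕ.suc n ×ᴿ 1#)

  fromℤ-⊖ : ∀ m n → fromℤ (m ⊖ n) ≈ m ×ᴿ 1# - n ×ᴿ 1#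
  fromℤ-⊖ ℕ.zero    ℕ.zero    = sym (-‿inverseʳ 0#)
  fromℤ-⊖ (ℕ.suc m) ℕ.zero    = sym (trans (+-congˡ -0#≈0#) (+-identityʳ _))
  fromℤ-⊖ ℕ.zero    (ℕ.suc n) = sym (+-identityˡ _)
  fromℤ-⊖ (ℕ.suc m) (ℕ.suc n) = begin
    fromℤ (ℕ.suc m ⊖ ℕ.suc n)            ≡⟨ ≡.cong fromℤ (ℤ.[1+m]⊖[1+n]≡m⊖n m n) ⟩
    fromℤ (m ⊖ n)                        ≈⟨ fromℤ-⊖ m n ⟩
    m ×ᴿ 1# - n ×ᴿ 1#                    ≈⟨ +-identityˡ _ ⟨
    0# + (m ×ᴿ 1# - n ×ᴿ 1#)             ≈⟨ +-congʳ (-‿inverseʳ 1#) ⟨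
    (1# - 1#) + (m ×ᴿ 1# - n ×ᴿ 1#)      ≈⟨ interchange _ _ _ _ ⟩
    (1# + m ×ᴿ 1#) + (- 1# - n ×ᴿ 1#)    ≈⟨ +-cong (sym (1+× m 1#)) (-‿+-comm 1# _) ⟩
    ℕ.suc m ×ᴿ 1# - (1# + n ×ᴿ 1#)       ≈⟨ +-congˡ (-‿cong (1+× n 1#)) ⟨
    ℕ.suc m ×ᴿ 1# - ℕ.suc n ×ᴿ 1#        ∎

  fromℤ-- : ∀ i → fromℤ (ℤ.- i) ≈ - fromℤ i
  fromℤ-- (+ ℕ.zero)  = sym -0#≈0#
  fromℤ-- (+ ℕ.suc n) = refl
  fromℤ-- -[1+ n ]    = sym (-‿involutive _)

  fromℤ-+ : ∀ i j → fromℤ (i ℤ.+ j) ≈ fromℤ i + fromℤ j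
  fromℤ-+ (+ m)    (+ n)    = ×-homo-+ 1# m n
  fromℤ-+ (+ m)    -[1+ n ] = fromℤ-⊖ m (ℕ.suc n)
  fromℤ-+ -[1+ m ] (+ n)    = trans (fromℤ-⊖ n (ℕ.suc m)) (+-comm _ _)
  fromℤ-+ -[1+ m ] -[1+ n ] = begin
    - (ℕ.suc (ℕ.suc (m ℕ.+ n)) ×ᴿ 1#)        ≡⟨ ≡.cong (λ k → - (ℕ.suc k ×ᴿ 1#)) (ℕ.+-suc m n) ⟨
    - ((ℕ.suc m ℕ.+ ℕ.suc n) ×ᴿ 1#)          ≈⟨ -‿cong (×-homo-+ 1# (ℕ.suc m) (ℕ.suc n)) ⟩
    - (ℕ.suc m ×ᴿ 1# + ℕ.suc n ×ᴿ 1#)        ≈⟨ -‿+-comm _ _ ⟨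
    - (ℕ.suc m ×ᴿ 1#) - ℕ.suc n ×ᴿ 1#        ∎

  fromℤ-◃⁺ : ∀ n → fromℤ (Sign.+ ◃ n) ≈ n ×ᴿ 1#
  fromℤ-◃⁺ ℕ.zero    = refl
  fromℤ-◃⁺ (ℕ.suc n) = refl

  fromℤ-◃⁻ : ∀ n → fromℤ (Sign.- ◃ n) ≈ - (n ×ᴿ 1#)
  fromℤ-◃⁻ ℕ.zero    = sym -0#≈0#
  fromℤ-◃⁻ (ℕ.suc n) = refl

  fromℤ-* : ∀ i j → fromℤ (i ℤ.* j) ≈ fromℤ i * fromℤ j
  fromℤ-* (+ m) (+ n) = trans (fromℤ-◃⁺ (m ℕ.* n)) (×1-homo-* m n)
  fromℤ-* (+ m) -[1+ n ] = begin
    fromℤ (Sign.- ◃ m ℕ.* ℕ.suc n)   ≈⟨ fromℤ-◃⁻ (m ℕ.* ℕ.suc n) ⟩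
    - ((m ℕ.* ℕ.suc n) ×ᴿ 1#)        ≈⟨ -‿cong (×1-homo-* m (ℕ.suc n)) ⟩
    - (m ×ᴿ 1# * ℕ.suc n ×ᴿ 1#)      ≈⟨ -‿distribʳ-* _ _ ⟩
    m ×ᴿ 1# * - (ℕ.suc n ×ᴿ 1#)      ∎
  fromℤ-* -[1+ m ] (+ n) = begin
    fromℤ (Sign.- ◃ ℕ.suc m ℕ.* n)   ≈⟨ fromℤ-◃⁻ (ℕ.suc m ℕ.* n) ⟩
    - ((ℕ.suc m ℕ.* n) ×ᴿ 1#)        ≈⟨ -‿cong (×1-homo-* (ℕ.suc m) n) ⟩
    - (ℕ.suc m ×ᴿ 1# * n ×ᴿ 1#)      ≈⟨ -‿distribˡ-* _ _ ⟩
    - (ℕ.suc m ×ᴿ 1#) * n ×ᴿ 1#      ∎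
  fromℤ-* -[1+ m ] -[1+ n ] = begin
    (ℕ.suc m ℕ.* ℕ.suc n) ×ᴿ 1#               ≈⟨ ×1-homo-* (ℕ.suc m) (ℕ.suc n) ⟩
    ℕ.suc m ×ᴿ 1# * ℕ.suc n ×ᴿ 1#             ≈⟨ -‿involutive _ ⟨
    - - (ℕ.suc m ×ᴿ 1# * ℕ.suc n ×ᴿ 1#)       ≈⟨ -‿cong (-‿distribˡ-* _ _) ⟩
    - (- (ℕ.suc m ×ᴿ 1#) * ℕ.suc n ×ᴿ 1#)     ≈⟨ -‿distribʳ-* _ _ ⟩
    - (ℕ.suc m ×ᴿ 1#) * - (ℕ.suc n ×ᴿ 1#)     ∎

  morphism : ℤ.+-*-rawRing -Raw-AlmostCommutative⟶ fromCommutativeRing R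
  morphism = record
    { ⟦_⟧    = fromℤ
    ; +-homo = fromℤ-+
    ; *-homo = fromℤ-*
    ; -‿homo = fromℤ--
    ; 0-homo = refl
    ; 1-homo = refl
    }

  -- Distinct integers may still agree in the ring, so a failed test yields no refutation; the
  -- solver asks for soundness only.
  fromℤ-≟ : WeaklyDecidable (Induced-equivalence morphism)
  fromℤ-≟ i j with i ℤ.≟ j
  ... | yes i≡j = just (reflexive (≡.cong fromℤ i≡j))
  ... | no _    = nothing

  open import Algebra.Solver.Ring ℤ.+-*-rawRing (fromCommutativeRing R) morphism fromℤ-≟ public
    using (Polynomial; con; solve; _:=_; _:+_; _:*_; _:-_; :-_)

  :0 :1 : ∀ {k} → Polynomial k
  :0 = con (+ 0)
  :1 = con (+ 1)

module _ (ℝ : Reals) where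

  open Reals ℝ hiding (zero)
  open Theory ℝ
  open IntegerCoefficientSolver commutativeRing
  open import Algebra.Properties.Ring ring
  open import Algebra.Properties.Semiring.Exp semiring using (_^_)
  open import Algebra.Properties.Semiring.Sum semiring
  open RawMonoidDefinitions *-rawMonoid using () renaming (sum to product)
  open import Relation.Binary.Reasoning.Setoid setoid

  -- Arithmetic of the ordered field

  open IsDecTotalOrder isDecTotalOrder
    using (_≤?_; ≤-respˡ-≈; ≤-respʳ-≈)
    renaming ( _≟_ to _≈?_; reflexive to ≤-reflexive; refl to ≤-refl; trans to ≤-trans
             ; antisym to ≤-antisym; total to ≤-total)

  ≤-resp₂-≈ : ∀ {x x′ y y′} → x ≈ x′ → y ≈ y′ → x ≤ y → x′ ≤ y′
  ≤-resp₂-≈ x≈x′ y≈y′ x≤y = ≤-respˡ-≈ x≈x′ (≤-respʳ-≈ y≈y′ x≤y)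

  -- Totality yields weak inequalities only; the refutation of `y ≤ x` is what excludes `x ≈ y`.
  <-or-≥ : ∀ x y → x <ᴿ y ⊎ y ≤ x
  <-or-≥ x y with y ≤? x | ≤-total x y
  ... | yes y≤x | _        = inj₂ y≤x
  ... | no _    | inj₂ y≤x = inj₂ y≤x
  ... | no y≰x  | inj₁ x≤y = inj₁ (x≤y , λ x≈y → y≰x (≤-reflexive (sym x≈y)))

  <⇒≱ : ∀ {x y} → x <ᴿ y → ¬ (y ≤ x)
  <⇒≱ (x≤y , x≉y) y≤x = x≉y (≤-antisym x≤y y≤x)

  <-≤-trans : ∀ {x y z} → x <ᴿ y → y ≤ z → x <ᴿ z
  <-≤-trans x<y y≤z = ≤-trans (proj₁ x<y) y≤z , λ x≈z → <⇒≱ x<y (≤-respʳ-≈ (sym x≈z) y≤z)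

  <-respʳ-≈ : ∀ {x y z} → y ≈ z → x <ᴿ y → x <ᴿ z
  <-respʳ-≈ y≈z x<y = <-≤-trans x<y (≤-reflexive y≈z)

  +-monoˡ-≤ : ∀ z {x y} → x ≤ y → x + z ≤ y + z
  +-monoˡ-≤ z x≤y = ≤-resp₂-≈ (+-comm z _) (+-comm z _) (+-monoʳ-≤ z x≤y)

  +-mono-≤ : ∀ {x y u v} → x ≤ y → u ≤ v → x + u ≤ y + v
  +-mono-≤ x≤y u≤v = ≤-trans (+-monoˡ-≤ _ x≤y) (+-monoʳ-≤ _ u≤v)

  x≤y⇒0≤y-x : ∀ {x y} → x ≤ y → 0# ≤ y - x
  x≤y⇒0≤y-x {x} x≤y = ≤-respˡ-≈ (-‿inverseʳ x) (+-monoˡ-≤ (- x) x≤y)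

  0≤y-x⇒x≤y : ∀ {x y} → 0# ≤ y - x → x ≤ y
  0≤y-x⇒x≤y {x} {y} 0≤y-x = ≤-resp₂-≈ (+-identityʳ x)
    (solve 2 (λ x y → x :+ (y :- x) := y) refl x y) (+-monoʳ-≤ x 0≤y-x)

  0≤x⇒-x≤0 : ∀ {x} → 0# ≤ x → - x ≤ 0#
  0≤x⇒-x≤0 {x} 0≤x = 0≤y-x⇒x≤y (≤-respʳ-≈ (sym (trans (+-identityˡ _) (-‿involutive x))) 0≤x)

  x≤0⇒0≤-x : ∀ {x} → x ≤ 0# → 0# ≤ - x
  x≤0⇒0≤-x x≤0 = ≤-respʳ-≈ (+-identityˡ _) (x≤y⇒0≤y-x x≤0)

  -‿anti-≤ : ∀ {x y} → x ≤ y → - y ≤ - x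
  -‿anti-≤ {x} {y} x≤y = 0≤y-x⇒x≤y
    (≤-respʳ-≈ (solve 2 (λ x y → y :- x := :- x :- (:- y)) refl x y) (x≤y⇒0≤y-x x≤y))

  *-monoʳ-≤ : ∀ {z x y} → 0# ≤ z → x ≤ y → z * x ≤ z * y
  *-monoʳ-≤ {z} {x} {y} 0≤z x≤y = 0≤y-x⇒x≤y
    (≤-respʳ-≈ (x[y-z]≈xy-xz z y x) (*-nonNegative 0≤z (x≤y⇒0≤y-x x≤y)))

  -- A nonzero `x` is cancelled by its inverse. This later turns complementarity into the choice of
  -- a tight action.
  x*y≈0⇒x≈0∨y≈0 : ∀ {x y} → x * y ≈ 0# → x ≈ 0# ⊎ y ≈ 0#
  x*y≈0⇒x≈0∨y≈0 {x} {y} xy≈0 with x ≈? 0#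
  ... | yes x≈0 = inj₁ x≈0
  ... | no x≉0 with inverse x x≉0
  ...   | x⁻¹ , xx⁻¹≈1 = inj₂ (begin
    y               ≈⟨ *-identityˡ y ⟨
    1# * y          ≈⟨ *-congʳ xx⁻¹≈1 ⟨
    x * x⁻¹ * y     ≈⟨ solve 3 (λ x z y → x :* z :* y := z :* (x :* y)) refl x x⁻¹ y ⟩
    x⁻¹ * (x * y)   ≈⟨ *-congˡ xy≈0 ⟩
    x⁻¹ * 0#        ≈⟨ zeroʳ x⁻¹ ⟩
    0#              ∎)

  *-positive : ∀ {x y} → 0# <ᴿ x → 0# <ᴿ y → 0# <ᴿ x * y
  *-positive (0≤x , 0≉x) (0≤y , 0≉y) = *-nonNegative 0≤x 0≤y , 0≉xy
    where
    0≉xy : ¬ (0# ≈ _)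
    0≉xy 0≈xy with x*y≈0⇒x≈0∨y≈0 (sym 0≈xy)
    ... | inj₁ x≈0 = 0≉x (sym x≈0)
    ... | inj₂ y≈0 = 0≉y (sym y≈0)

  0≤x*x : ∀ x → 0# ≤ x * x
  0≤x*x x with ≤-total 0# x
  ... | inj₁ 0≤x = *-nonNegative 0≤x 0≤x
  ... | inj₂ x≤0 = ≤-respʳ-≈ (solve 1 (λ x → (:- x) :* (:- x) := x :* x) refl x)
                     (*-nonNegative (x≤0⇒0≤-x x≤0) (x≤0⇒0≤-x x≤0))

  0≤1 : 0# ≤ 1#
  0≤1 = ≤-respʳ-≈ (*-identityˡ 1#) (0≤x*x 1#)

  -- The order replaces division by two: `x` and `- x` lie on opposite sides of zero.
  x≈-x⇒x≈0 : ∀ {x} → x ≈ - x → x ≈ 0#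
  x≈-x⇒x≈0 {x} x≈-x with ≤-total 0# x
  ... | inj₁ 0≤x = ≤-antisym (≤-respˡ-≈ (sym x≈-x) (0≤x⇒-x≤0 0≤x)) 0≤x
  ... | inj₂ x≤0 = ≤-antisym x≤0 (≤-respʳ-≈ (sym x≈-x) (x≤0⇒0≤-x x≤0))

  x-y≈0⇒x≈y : ∀ {x y} → x - y ≈ 0# → x ≈ y
  x-y≈0⇒x≈y = x∙y⁻¹≈ε⇒x≈y _ _

  -- Finite sums

  sum-mono-≤ : ∀ {n} {f g : Vec n} → (∀ i → f i ≤ g i) → sum f ≤ sum g
  sum-mono-≤ {zero}  f≤g = ≤-refl
  sum-mono-≤ {suc n} f≤g = +-mono-≤ (f≤g zero) (sum-mono-≤ (f≤g ∘ suc))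

  sum-zero : ∀ {n} {f : Vec n} → (∀ i → f i ≈ 0#) → sum f ≈ 0#
  sum-zero {n} f≈0 = trans (sum-cong-≋ f≈0) (sum-replicate-zero n)

  sum-nonNegative : ∀ {n} {f : Vec n} → (∀ i → 0# ≤ f i) → 0# ≤ sum f
  sum-nonNegative {n} 0≤f = ≤-respˡ-≈ (sum-replicate-zero n) (sum-mono-≤ 0≤f)

  sum-support : ∀ {n} (f : Vec n) i → (∀ j → i ≢ j → f j ≈ 0#) → sum f ≈ f i
  sum-support {suc n} f i f≈0 = begin
    sum f                      ≈⟨ sum-remove {i = i} f ⟩
    f i + sum (removeAt f i)   ≈⟨ +-congˡ (sum-zero λ j → f≈0 (punchIn i j) (punchInᵢ≢i i j ∘ ≡.sym)) ⟩
    f i + 0#                   ≈⟨ +-identityʳ _ ⟩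
    f i                        ∎

  sum-- : ∀ {n} (f : Vec n) → sum (-_ ∘ f) ≈ - sum f
  sum-- f = begin
    sum (-_ ∘ f)               ≈⟨ sum-cong-≋ (λ i → -1*x≈-x (f i)) ⟨
    sum (λ i → - 1# * f i)     ≈⟨ *-distribˡ-sum (- 1#) f ⟨
    - 1# * sum f               ≈⟨ -1*x≈-x (sum f) ⟩
    - sum f                    ∎

  sum-distrib-- : ∀ {n} (f g : Vec n) → sum (λ i → f i - g i) ≈ sum f - sum g
  sum-distrib-- f g = trans (∑-distrib-+ f (-_ ∘ g)) (+-congˡ (sum-- g))

  -- Scalar matrices and matrix-vector products

  scalarMatrix-diagonal : ∀ {k} c i → scalarMatrix k c i i ≈ c
  scalarMatrix-diagonal c i with i ≟ i
  ... | yes _  = refl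
  ... | no i≢i = contradiction ≡.refl i≢i

  scalarMatrix-offDiagonal : ∀ {k} c i j → i ≢ j → scalarMatrix k c i j ≈ 0#
  scalarMatrix-offDiagonal c i j i≢j with i ≟ j
  ... | yes i≡j = contradiction i≡j i≢j
  ... | no _    = refl

  scalarMatrix-·ᵛ : ∀ {k} c (x : Vec k) i → (scalarMatrix k c ·ᵛ x) i ≈ c * x i
  scalarMatrix-·ᵛ {k} c x i = trans
    (sum-support _ i λ j i≢j → trans (*-congʳ (scalarMatrix-offDiagonal c i j i≢j)) (zeroˡ _))
    (*-congʳ (scalarMatrix-diagonal c i))

  ·ᵛ-cong : ∀ {m n} (A : Matrix m n) {x y : Vec n} → (∀ j → x j ≈ y j) →
            ∀ i → (A ·ᵛ x) i ≈ (A ·ᵛ y) i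
  ·ᵛ-cong A x≈y i = sum-cong-≋ λ j → *-congˡ (x≈y j)

  ·ᵛ-distribˡ-+ : ∀ {m n} (A : Matrix m n) (x y : Vec n) i →
                  (A ·ᵛ λ j → x j + y j) i ≈ (A ·ᵛ x) i + (A ·ᵛ y) i
  ·ᵛ-distribˡ-+ {n = n} A x y i =
    trans (sum-cong-≋ {n} λ j → distribˡ (A i j) (x j) (y j)) (∑-distrib-+ {n} _ _)

  ·ᵛ-neg : ∀ {m n} (A : Matrix m n) (x : Vec n) i → (A ·ᵛ λ j → - x j) i ≈ - (A ·ᵛ x) i
  ·ᵛ-neg {n = n} A x i = trans (sum-cong-≋ {n} λ j → sym (-‿distribʳ-* (A i j) (x j))) (sum-- {n} _)

  ·ᵛ-distribˡ-- : ∀ {m n} (A : Matrix m n) (x y : Vec n) i →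
                  (A ·ᵛ λ j → x j - y j) i ≈ (A ·ᵛ x) i - (A ·ᵛ y) i
  ·ᵛ-distribˡ-- A x y i = trans (·ᵛ-distribˡ-+ A x _ i) (+-congˡ (·ᵛ-neg A y i))

  ·ᵛ-assoc : ∀ {l m n} (A : Matrix l m) (B : Matrix m n) (x : Vec n) i →
             ((A · B) ·ᵛ x) i ≈ (A ·ᵛ (B ·ᵛ x)) i
  ·ᵛ-assoc {m = m} {n} A B x i = begin
    sum {n} (λ k → sum {m} (λ j → A i j * B j k) * x k)
      ≈⟨ sum-cong-≋ {n} (λ k → *-distribʳ-sum {m} (x k) _) ⟩
    sum {n} (λ k → sum {m} (λ j → A i j * B j k * x k))
      ≈⟨ ∑-comm {n} {m} _ ⟩
    sum {m} (λ j → sum {n} (λ k → A i j * B j k * x k))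
      ≈⟨ sum-cong-≋ {m} (λ j → sum-cong-≋ {n} λ k → *-assoc (A i j) (B j k) (x k)) ⟩
    sum {m} (λ j → sum {n} (λ k → A i j * (B j k * x k)))
      ≈⟨ sum-cong-≋ {m} (λ j → *-distribˡ-sum {n} (A i j) _) ⟨
    sum {m} (λ j → A i j * sum {n} (λ k → B j k * x k)) ∎

  -- Determinants and Schur complements

  -- The nested subtraction produces the alternating signs. Entries passed over are put back by
  -- `c ∷_`, so `f` always sees the list with exactly one entry deleted.
  expand : ∀ {C : Set} → (C → Carrier) → (List C → Carrier) → List C → Carrier
  expand h f []       = 0#
  expand h f (c ∷ cs) = h c * f cs - expand h (f ∘ (c ∷_)) cs

  -- Laplace expansion for a list of columns: unlike the recursion of det it
  -- does no index arithmetic.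
  detᶜ : ∀ n → List (Vec n) → Carrier
  detᶜ zero    []       = 1#
  detᶜ zero    (_ ∷ _)  = 0#
  detᶜ (suc n) cs       = expand head (detᶜ n ∘ List.map tail) cs

  -- Subtracting the expansion of the remaining list negates all its terms, which raises each
  -- exponent of `- 1#` by one.
  expand-tabulate : ∀ {C : Set} {m} (h : C → Carrier) f (g : Fin (suc m) → C) →
    expand h f (tabulate g) ≈
    sum λ j → (- 1#) ^ toℕ j * (h (g j) * f (tabulate (removeAt g j)))
  expand-tabulate {m = zero} h f g =
    solve 1 (λ x → x :- :0 := :1 :* x :+ :0) refl _
  expand-tabulate {m = suc m} h f g = begin
    x - expand h (f ∘ (g zero ∷_)) (tabulate (g ∘ suc))
      ≈⟨ +-congˡ (-‿cong (expand-tabulate h (f ∘ (g zero ∷_)) (g ∘ suc))) ⟩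
    x - sum y
      ≈⟨ +-cong (sym (*-identityˡ x)) (sym (sum-- y)) ⟩
    1# * x + sum (-_ ∘ y)
      ≈⟨ +-congˡ (sum-cong-≋ λ j → trans (sym (-1*x≈-x (y j))) (sym (*-assoc _ _ _))) ⟩
    1# * x + sum (λ j → (- 1#) ^ suc (toℕ j) *
                        (h (g (suc j)) * f (tabulate (removeAt g (suc j))))) ∎
    where
    x = h (g zero) * f (tabulate (g ∘ suc))
    y : Vec (suc m)
    y j = (- 1#) ^ toℕ j * (h (g (suc j)) * f (tabulate (removeAt g (suc j))))

  -- The list holds columns: their heads form the row along which `det` expands, and mapping `tail`
  -- deletes that row.
  det≈detᶜ : ∀ {n} (A : Matrix n n) → det A ≈ detᶜ n (tabulate λ k i → A i k)
  det≈detᶜ {zero}  A = refl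
  det≈detᶜ {suc n} A = begin
    sum (λ j → (- 1#) ^ toℕ j * (A zero j * det (λ i → removeAt (A (suc i)) j)))
      ≈⟨ sum-cong-≋ (λ j → *-congˡ {(- 1#) ^ toℕ j} (*-congˡ {A zero j} (minor j))) ⟩
    sum (λ j → (- 1#) ^ toℕ j * (A zero j * detᶜ n (List.map tail (tabulate (removeAt column j)))))
      ≈⟨ expand-tabulate head (detᶜ n ∘ List.map tail) column ⟨
    detᶜ (suc n) (tabulate column) ∎
    where
    column : Fin (suc n) → Vec (suc n)
    column k i = A i k
    minor : ∀ j → det (λ i → removeAt (A (suc i)) j) ≈
                  detᶜ n (List.map tail (tabulate (removeAt column j)))
    minor j = trans (det≈detᶜ (λ i → removeAt (A (suc i)) j))
      (reflexive (≡.cong (detᶜ n) (≡.sym (map-tabulate (removeAt column j) tail))))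

  module _ {C : Set} (h : C → Carrier) where

    -- The hypothesis ranges over all lists because the recursion replaces `f` by `f ∘ (c ∷_)`.
    expand-neg : ∀ {f g} → (∀ xs → f xs ≈ - g xs) → ∀ xs → expand h f xs ≈ - expand h g xs
    expand-neg         f≈-g []       = sym -0#≈0#
    expand-neg {f} {g} f≈-g (c ∷ cs) = begin
      h c * f cs - expand h (f ∘ (c ∷_)) cs
        ≈⟨ +-cong (*-congˡ (f≈-g cs)) (-‿cong (expand-neg (f≈-g ∘ (c ∷_)) cs)) ⟩
      h c * - g cs - - expand h (g ∘ (c ∷_)) cs
        ≈⟨ solve 3 (λ a b e → a :* (:- b) :- (:- e) := :- (a :* b :- e)) refl _ _ _ ⟩
      - (h c * g cs - expand h (g ∘ (c ∷_)) cs) ∎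

    expand-combination : ∀ {k f g l} → (∀ xs → f xs ≈ g xs + k * l xs) →
                         ∀ xs → expand h f xs ≈ expand h g xs + k * expand h l xs
    expand-combination {k}             f≈g+kl []       =
      sym (trans (+-identityˡ _) (zeroʳ k))
    expand-combination {k} {f} {g} {l} f≈g+kl (c ∷ cs) = begin
      h c * f cs - expand h (f ∘ (c ∷_)) cs
        ≈⟨ +-cong (*-congˡ (f≈g+kl cs)) (-‿cong (expand-combination (f≈g+kl ∘ (c ∷_)) cs)) ⟩
      h c * (g cs + k * l cs) - (expand h (g ∘ (c ∷_)) cs + k * expand h (l ∘ (c ∷_)) cs)
        ≈⟨ solve 6 (λ a b k d e f → a :* (b :+ k :* d) :- (e :+ k :* f)
                                  := (a :* b :- e) :+ k :* (a :* d :- f)) refl _ _ _ _ _ _ ⟩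
      (h c * g cs - expand h (g ∘ (c ∷_)) cs) + k * (h c * l cs - expand h (l ∘ (c ∷_)) cs) ∎

    expand-vanishing : ∀ {xs} f → All (λ c → h c ≈ 0#) xs → expand h f xs ≈ 0#
    expand-vanishing          f []            = refl
    expand-vanishing {c ∷ cs} f (hc≈0 ∷ hcs≈0) = begin
      h c * f cs - expand h (f ∘ (c ∷_)) cs
        ≈⟨ +-cong (*-congʳ hc≈0) (-‿cong (expand-vanishing (f ∘ (c ∷_)) hcs≈0)) ⟩
      0# * f cs - 0#
        ≈⟨ solve 1 (λ x → :0 :* x :- :0 := :0) refl _ ⟩
      0# ∎

  -- Antisymmetric functions of lists

  data Swap {C : Set} : List C → List C → Set where
    here  : ∀ {c d cs}   → Swap (c ∷ d ∷ cs) (d ∷ c ∷ cs)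
    there : ∀ {c cs cs′} → Swap cs cs′ → Swap (c ∷ cs) (c ∷ cs′)

  Swap-map : ∀ {C D : Set} (t : C → D) {cs cs′} → Swap cs cs′ → Swap (List.map t cs) (List.map t cs′)
  Swap-map t here      = here
  Swap-map t (there s) = there (Swap-map t s)

  Antisymmetric : ∀ {C : Set} → (List C → Carrier) → Set
  Antisymmetric f = ∀ {cs cs′} → Swap cs cs′ → f cs ≈ - f cs′

  -- Swapping the two leading entries exchanges the first two terms, which carry opposite signs. In
  -- the later terms both entries are still arguments of `f`, whose antisymmetry applies.
  expand-antisymmetric : ∀ {C : Set} (h : C → Carrier) {f} → Antisymmetric f → Antisymmetric (expand h f)
  expand-antisymmetric h {f} anti (here {c} {d} {cs}) = begin
    h c * f (d ∷ cs) - (h d * f (c ∷ cs) - expand h (λ xs → f (c ∷ d ∷ xs)) cs)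
      ≈⟨ +-congˡ (-‿cong (+-congˡ (-‿cong (expand-neg h (λ _ → anti here) cs)))) ⟩
    h c * f (d ∷ cs) - (h d * f (c ∷ cs) - - expand h (λ xs → f (d ∷ c ∷ xs)) cs)
      ≈⟨ solve 3 (λ a b e → a :- (b :- (:- e)) := :- (b :- (a :- e))) refl _ _ _ ⟩
    - (h d * f (c ∷ cs) - (h c * f (d ∷ cs) - expand h (λ xs → f (d ∷ c ∷ xs)) cs)) ∎
  expand-antisymmetric h {f} anti (there {c} {cs} {cs′} s) = begin
    h c * f cs - expand h (f ∘ (c ∷_)) cs
      ≈⟨ +-cong (*-congˡ (anti s)) (-‿cong (expand-antisymmetric h (anti ∘ there) s)) ⟩
    h c * - f cs′ - - expand h (f ∘ (c ∷_)) cs′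
      ≈⟨ solve 3 (λ a b e → a :* (:- b) :- (:- e) := :- (a :* b :- e)) refl _ _ _ ⟩
    - (h c * f cs′ - expand h (f ∘ (c ∷_)) cs′) ∎

  -- In the base case the list is nonempty, where `detᶜ` has the default value 0; hence the property
  -- holds for lists of every length.
  detᶜ-antisymmetric : ∀ n → Antisymmetric (detᶜ n)
  detᶜ-antisymmetric zero    here      = sym -0#≈0#
  detᶜ-antisymmetric zero    (there s) = sym -0#≈0#
  detᶜ-antisymmetric (suc n) s         =
    expand-antisymmetric head (detᶜ-antisymmetric n ∘ Swap-map tail) s

  -- Adjacent swaps move `c` towards its copy; once the two are neighbours, swapping them changes
  -- nothing but the sign.
  antisymmetric⇒alternating : ∀ {C : Set} {f : List C → Carrier} → Antisymmetric f →
                              ∀ {c cs} → c ∈ cs → f (c ∷ cs) ≈ 0#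
  antisymmetric⇒alternating anti (here ≡.refl) = x≈-x⇒x≈0 (anti here)
  antisymmetric⇒alternating anti (there c∈cs)  = trans (anti here)
    (trans (-‿cong (antisymmetric⇒alternating (anti ∘ there) c∈cs)) -0#≈0#)

  -- Multilinear functions of lists of columns

  infixl 6 _+[_]_

  _+[_]_ : ∀ {n} → Vec n → Carrier → Vec n → Vec n
  (u +[ k ] v) i = u i + k * v i

  -- Addition and scaling in one position are fused into a single relation, so that linearity in
  -- every column is one equation.
  data Combination {n} (k : Carrier) : List (Vec n) → List (Vec n) → List (Vec n) → Set where
    here  : ∀ {u v cs} → Combination k (u +[ k ] v ∷ cs) (u ∷ cs) (v ∷ cs)
    there : ∀ {c as us vs} → Combination k as us vs → Combination k (c ∷ as) (c ∷ us) (c ∷ vs)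

  Combination-tail : ∀ {n k} {as us vs : List (Vec (suc n))} → Combination k as us vs →
    Combination k (List.map tail as) (List.map tail us) (List.map tail vs)
  Combination-tail here      = here
  Combination-tail (there s) = there (Combination-tail s)

  Multilinear : ∀ {n} → (List (Vec n) → Carrier) → Set
  Multilinear f = ∀ {k as us vs} → Combination k as us vs → f as ≈ f us + k * f vs

  -- In the term that deletes the combined column, linearity comes from `head`; in all other terms
  -- it comes from `f`.
  expand-multilinear : ∀ {n} {f : List (Vec (suc n)) → Carrier} →
                       Multilinear f → Multilinear (expand head f)
  expand-multilinear {f = f} lin {k} (here {u} {v} {cs}) = begin
    (u zero + k * v zero) * f cs - expand head (f ∘ (u +[ k ] v ∷_)) cs
      ≈⟨ +-congˡ (-‿cong (expand-combination head (λ xs → lin (here {cs = xs})) cs)) ⟩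
    (u zero + k * v zero) * f cs - (expand head (f ∘ (u ∷_)) cs + k * expand head (f ∘ (v ∷_)) cs)
      ≈⟨ solve 6 (λ u k v a b c → (u :+ k :* v) :* a :- (b :+ k :* c)
                                := (u :* a :- b) :+ k :* (v :* a :- c)) refl _ _ _ _ _ _ ⟩
    (u zero * f cs - expand head (f ∘ (u ∷_)) cs) +
    k * (v zero * f cs - expand head (f ∘ (v ∷_)) cs) ∎
  expand-multilinear {f = f} lin {k} (there {c} {as} {us} {vs} s) = begin
    c zero * f as - expand head (f ∘ (c ∷_)) as
      ≈⟨ +-cong (*-congˡ (lin s)) (-‿cong (expand-multilinear (lin ∘ there) s)) ⟩
    c zero * (f us + k * f vs) - (expand head (f ∘ (c ∷_)) us + k * expand head (f ∘ (c ∷_)) vs)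
      ≈⟨ solve 6 (λ a b k d e f → a :* (b :+ k :* d) :- (e :+ k :* f)
                                := (a :* b :- e) :+ k :* (a :* d :- f)) refl _ _ _ _ _ _ ⟩
    (c zero * f us - expand head (f ∘ (c ∷_)) us) +
    k * (c zero * f vs - expand head (f ∘ (c ∷_)) vs) ∎

  detᶜ-multilinear : ∀ n → Multilinear (detᶜ n)
  detᶜ-multilinear zero    {k} here      = sym (trans (+-identityˡ _) (zeroʳ k))
  detᶜ-multilinear zero    {k} (there _) = sym (trans (+-identityˡ _) (zeroʳ k))
  detᶜ-multilinear (suc n)     s         =
    expand-multilinear (detᶜ-multilinear n ∘ Combination-tail) s

  -- Column operations: `f` stands for a determinant that already has `c` among its columns, so
  -- every correction term contains `c` twice and vanishes.
  add-multiples : ∀ {n} {f : List (Vec n) → Carrier} {c} → Multilinear f →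
    (∀ {xs} → c ∈ xs → f xs ≈ 0#) → (φ : Vec n → Carrier) →
    ∀ xs → f (List.map (λ x → x +[ φ x ] c) xs) ≈ f xs
  add-multiples             lin f≈0 φ []       = refl
  add-multiples {f = f} {c} lin f≈0 φ (x ∷ xs) = begin
    f (x +[ φ x ] c ∷ ys)          ≈⟨ lin here ⟩
    f (x ∷ ys) + φ x * f (c ∷ ys)  ≈⟨ +-congˡ (trans (*-congˡ (f≈0 (here ≡.refl))) (zeroʳ _)) ⟩
    f (x ∷ ys) + 0#                ≈⟨ +-identityʳ _ ⟩
    f (x ∷ ys)                     ≈⟨ add-multiples (lin ∘ there) (f≈0 ∘ there) φ xs ⟩
    f (x ∷ xs)                     ∎
    where ys = List.map (λ x → x +[ φ x ] c) xs

  -- The Schur complement of the top left entry, when `a⁻¹` inverts it. The entries are written as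
  -- the results of column operations, so that they match those in `det-schur` definitionally.
  schur : ∀ {n} → Matrix (suc n) (suc n) → Carrier → Matrix n n
  schur A a⁻¹ i j = A (suc i) (suc j) + - (A zero (suc j) * a⁻¹) * A (suc i) zero

  -- Multiples of the first column clear the rest of the first row, after which the Laplace
  -- expansion has a single term.
  det-schur : ∀ {n} (A : Matrix (suc n) (suc n)) {a⁻¹} → A zero zero * a⁻¹ ≈ 1# →
              det A ≈ A zero zero * det (schur A a⁻¹)
  det-schur {n} A {a⁻¹} aa⁻¹≈1 = begin
    det A
      ≈⟨ det≈detᶜ A ⟩
    detᶜ (suc n) (c ∷ cs)
      ≈⟨ add-multiples {c = c} (detᶜ-multilinear (suc n) ∘ there {c = c})
           (antisymmetric⇒alternating (detᶜ-antisymmetric (suc n))) φ cs ⟨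
    A zero zero * detᶜ n (List.map tail (List.map clear cs)) -
    expand head (detᶜ n ∘ List.map tail ∘ (c ∷_)) (List.map clear cs)
      ≈⟨ +-cong (*-congˡ (reflexive (≡.cong (detᶜ n) tails)))
                (-‿cong (expand-vanishing head _ (All.map⁺ (All.universal cleared cs)))) ⟩
    A zero zero * detᶜ n (tabulate λ k i → schur A a⁻¹ i k) - 0#
      ≈⟨ trans (+-congˡ -0#≈0#) (+-identityʳ _) ⟩
    A zero zero * detᶜ n (tabulate λ k i → schur A a⁻¹ i k)
      ≈⟨ *-congˡ (det≈detᶜ (schur A a⁻¹)) ⟨
    A zero zero * det (schur A a⁻¹) ∎
    where
    c : Vec (suc n)
    c i = A i zero
    column : Fin n → Vec (suc n)
    column k i = A i (suc k)
    cs = tabulate column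
    φ : Vec (suc n) → Carrier
    φ x = - (x zero * a⁻¹)
    clear : Vec (suc n) → Vec (suc n)
    clear x = x +[ φ x ] c
    cleared : ∀ x → clear x zero ≈ 0#
    cleared x = begin
      x zero + - (x zero * a⁻¹) * A zero zero
        ≈⟨ solve 3 (λ x r a → x :+ (:- (x :* r)) :* a := x :- x :* (a :* r)) refl _ _ _ ⟩
      x zero - x zero * (A zero zero * a⁻¹)
        ≈⟨ +-congˡ (-‿cong (trans (*-congˡ aa⁻¹≈1) (*-identityʳ _))) ⟩
      x zero - x zero
        ≈⟨ -‿inverseʳ _ ⟩
      0# ∎
    tails : List.map tail (List.map clear cs) ≡ tabulate λ k i → schur A a⁻¹ i k
    tails = ≡.trans (≡.cong (List.map tail) (map-tabulate column clear))
                    (map-tabulate (clear ∘ column) tail)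

  -- Matrices that reverse the sign of no nonzero vector

  -- The classical sign criterion for P-matrices, due to Fiedler and Pták. Unlike minors, it is
  -- easily checked for a product with an inverse matrix.
  ReversesNoSign : ∀ {n} → Matrix n n → Set
  ReversesNoSign A = ∀ x → (∀ i → x i * (A ·ᵛ x) i ≤ 0#) → ∀ i → x i ≈ 0#

  x≈0⇒x*y≤0 : ∀ {x y} → x ≈ 0# → x * y ≤ 0#
  x≈0⇒x*y≤0 x≈0 = ≤-reflexive (trans (*-congʳ x≈0) (zeroˡ _))

  -- If the entry were nonpositive, the sign of the first unit vector would be reversed.
  pivot-positive : ∀ {n} (A : Matrix (suc n) (suc n)) → ReversesNoSign A → 0# <ᴿ A zero zero
  pivot-positive {n} A A-rns with <-or-≥ 0# (A zero zero)
  ... | inj₁ 0<a = 0<a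
  ... | inj₂ a≤0 = contradiction (sym (A-rns e reversed zero)) 0≉1
    where
    e : Vec (suc n)
    e zero    = 1#
    e (suc _) = 0#
    reversed : ∀ i → e i * (A ·ᵛ e) i ≤ 0#
    reversed zero    = ≤-respˡ-≈ (sym eq) a≤0
      where
      eq : e zero * (A ·ᵛ e) zero ≈ A zero zero
      eq = begin
        1# * (A ·ᵛ e) zero     ≈⟨ *-identityˡ _ ⟩
        (A ·ᵛ e) zero          ≈⟨ sum-support (λ j → A zero j * e j) zero
                                    (λ { zero 0≢0 → contradiction ≡.refl 0≢0 ; (suc j) _ → zeroʳ _ }) ⟩
        A zero zero * 1#       ≈⟨ *-identityʳ _ ⟩
        A zero zero            ∎
    reversed (suc i) = x≈0⇒x*y≤0 refl

  -- x extends to the vector x₀ ∷ x whose image under A has zeroth entry 0; its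
  -- other entries are those of the image of x under the Schur complement.
  schur-reversesNoSign : ∀ {n} (A : Matrix (suc n) (suc n)) {a⁻¹} → A zero zero * a⁻¹ ≈ 1# →
                         ReversesNoSign A → ReversesNoSign (schur A a⁻¹)
  schur-reversesNoSign {n} A {a⁻¹} aa⁻¹≈1 A-rns x reversed = A-rns x₀∷x reversed′ ∘ suc
    where
    row : Fin (suc n) → Carrier
    row i = sum λ j → A i (suc j) * x j
    x₀∷x : Vec (suc n)
    x₀∷x zero    = - (a⁻¹ * row zero)
    x₀∷x (suc j) = x j
    image₀ : (A ·ᵛ x₀∷x) zero ≈ 0#
    image₀ = begin
      A zero zero * - (a⁻¹ * row zero) + row zero
        ≈⟨ solve 3 (λ a r s → a :* (:- (r :* s)) :+ s := s :- (a :* r) :* s) refl _ _ _ ⟩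
      row zero - (A zero zero * a⁻¹) * row zero
        ≈⟨ +-congˡ (-‿cong (trans (*-congʳ aa⁻¹≈1) (*-identityˡ _))) ⟩
      row zero - row zero
        ≈⟨ -‿inverseʳ _ ⟩
      0# ∎
    image : ∀ i → (schur A a⁻¹ ·ᵛ x) i ≈ (A ·ᵛ x₀∷x) (suc i)
    image i = begin
      sum (λ j → schur A a⁻¹ i j * x j)
        ≈⟨ sum-cong-≋ (λ j → solve 5 (λ d r s b x → (d :+ :- (r :* s) :* b) :* x
                                                  := d :* x :+ (:- (b :* s)) :* (r :* x))
                                     refl (A (suc i) (suc j)) (A zero (suc j)) a⁻¹ b (x j)) ⟩
      sum (λ j → A (suc i) (suc j) * x j + (- (b * a⁻¹)) * (A zero (suc j) * x j))
        ≈⟨ ∑-distrib-+ {n} _ _ ⟩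
      row (suc i) + sum (λ j → (- (b * a⁻¹)) * (A zero (suc j) * x j))
        ≈⟨ +-congˡ (*-distribˡ-sum {n} (- (b * a⁻¹)) _) ⟨
      row (suc i) + (- (b * a⁻¹)) * row zero
        ≈⟨ solve 4 (λ d b r s → d :+ (:- (b :* r)) :* s := b :* (:- (r :* s)) :+ d) refl _ _ _ _ ⟩
      b * - (a⁻¹ * row zero) + row (suc i) ∎
      where b = A (suc i) zero
    reversed′ : ∀ i → x₀∷x i * (A ·ᵛ x₀∷x) i ≤ 0#
    reversed′ zero    = ≤-reflexive (trans (*-congˡ image₀) (zeroʳ _))
    reversed′ (suc i) = ≤-respˡ-≈ (*-congˡ (image i)) (reversed i)

  -- Induction by Gaussian elimination: the pivot is positive and the Schur complement inherits the
  -- hypothesis.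
  reversesNoSign⇒0<det : ∀ {n} (A : Matrix n n) → ReversesNoSign A → 0# <ᴿ det A
  reversesNoSign⇒0<det {zero}  A A-rns = 0≤1 , 0≉1
  reversesNoSign⇒0<det {suc n} A A-rns
    with 0<a ← pivot-positive A A-rns
    with a⁻¹ , aa⁻¹≈1 ← inverse (A zero zero) (proj₂ 0<a ∘ sym) =
    <-respʳ-≈ (sym (det-schur A aa⁻¹≈1))
      (*-positive 0<a (reversesNoSign⇒0<det (schur A a⁻¹) (schur-reversesNoSign A aa⁻¹≈1 A-rns)))

  -- A vector on the index set is extended by zero: on the set the image is that of the submatrix,
  -- and elsewhere the products vanish.
  principal-reversesNoSign : ∀ {k n} (A : Matrix n n) {α : Fin k → Fin n} →
    (∀ {i j} → α i ≡ α j → i ≡ j) → ReversesNoSign A → ReversesNoSign (λ i j → A (α i) (α j))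
  principal-reversesNoSign {k} {n} A {α} α-injective A-rns x reversed l =
    trans (sym (x̂∘α l)) (A-rns x̂ reversed′ (α l))
    where
    -- Column `l` is the unit vector at `α l`, so multiplication by `E` extends by zero and `A · E`
    -- selects columns of `A`.
    E : Matrix n k
    E i l = scalarMatrix n 1# i (α l)
    x̂ : Vec n
    x̂ = E ·ᵛ x
    x̂∘α : ∀ l → x̂ (α l) ≈ x l
    x̂∘α l = begin
      x̂ (α l)             ≈⟨ sum-support (λ l′ → E (α l) l′ * x l′) l (λ l′ l≢l′ → trans
                               (*-congʳ (scalarMatrix-offDiagonal 1# (α l) (α l′) (l≢l′ ∘ α-injective)))
                               (zeroˡ _)) ⟩
      E (α l) l * x l     ≈⟨ *-congʳ (scalarMatrix-diagonal 1# (α l)) ⟩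
      1# * x l            ≈⟨ *-identityˡ _ ⟩
      x l                 ∎
    A·E : ∀ i l → (A · E) i l ≈ A i (α l)
    A·E i l = begin
      (A · E) i l          ≈⟨ sum-support (λ m → A i m * E m l) (α l) (λ m αl≢m → trans
                                (*-congˡ (scalarMatrix-offDiagonal 1# m (α l) (αl≢m ∘ ≡.sym)))
                                (zeroʳ _)) ⟩
      A i (α l) * E (α l) l ≈⟨ *-congˡ (scalarMatrix-diagonal 1# (α l)) ⟩
      A i (α l) * 1#       ≈⟨ *-identityʳ _ ⟩
      A i (α l)            ∎
    image : ∀ i → (A ·ᵛ x̂) i ≈ sum λ l → A i (α l) * x l
    image i = trans (sym (·ᵛ-assoc A E x i)) (sum-cong-≋ {k} λ l → *-congʳ (A·E i l))
    reversed′ : ∀ i → x̂ i * (A ·ᵛ x̂) i ≤ 0#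
    reversed′ i with any? (λ l → i ≟ α l)
    ... | yes (l , ≡.refl) = ≤-respˡ-≈ (*-cong (sym (x̂∘α l)) (sym (image (α l)))) (reversed l)
    ... | no i∉α = x≈0⇒x*y≤0 (sum-zero λ l → trans
                     (*-congʳ (scalarMatrix-offDiagonal 1# i (α l) (λ i≡αl → i∉α (l , i≡αl))))
                     (zeroˡ _))

  reversesNoSign⇒IsPMatrix : ∀ {n} (A : Matrix n n) → ReversesNoSign A → IsPMatrix A
  reversesNoSign⇒IsPMatrix A A-rns α α-increasing =
    reversesNoSign⇒0<det _ (principal-reversesNoSign A α-injective A-rns)
    where
    α-injective : ∀ {i j} → α i ≡ α j → i ≡ j
    α-injective {i} {j} αi≡αj with <-cmp i j
    ... | tri< i<j _ _ = contradiction αi≡αj (<⇒≢ (α-increasing i<j))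
    ... | tri≈ _ i≡j _ = i≡j
    ... | tri> _ _ j<i = contradiction (≡.sym αi≡αj) (<⇒≢ (α-increasing j<i))

  -- Discounted stochastic matrices

  abstract

    argmax : ∀ {n} (x : Vec (suc n)) → ∃[ m ] (∀ i → x i ≤ x m)
    argmax {zero}  x = zero , λ { zero → ≤-refl }
    argmax {suc n} x with argmax (x ∘ suc)
    ... | m , x≤xₘ with ≤-total (x zero) (x (suc m))
    ...   | inj₁ x₀≤xₘ = suc m , λ { zero → x₀≤xₘ ; (suc i) → x≤xₘ i }
    ...   | inj₂ xₘ≤x₀ = zero  , λ { zero → ≤-refl ; (suc i) → ≤-trans (x≤xₘ i) xₘ≤x₀ }

    argmin : ∀ {n} (x : Vec (suc n)) → ∃[ m ] (∀ i → x m ≤ x i)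
    argmin x with argmax (-_ ∘ x)
    ... | m , -x≤-xₘ = m , λ i →
      ≤-resp₂-≈ (-‿involutive _) (-‿involutive _) (-‿anti-≤ (-x≤-xₘ i))

    bounded-above : ∀ {n} (x : Vec n) → ∃[ b ] (∀ i → x i ≤ b)
    bounded-above {zero}  x = 0# , λ ()
    bounded-above {suc n} x with argmax x
    ... | m , x≤xₘ = x m , x≤xₘ

    bounded-below : ∀ {n} (x : Vec n) → ∃[ b ] (∀ i → b ≤ x i)
    bounded-below {zero}  x = 0# , λ ()
    bounded-below {suc n} x with argmin x
    ... | m , xₘ≤x = x m , xₘ≤x

  block-bounded-above : ∀ {n} {b : Fin n → ℕ} (x : BlockVec b) → ∃[ c ] (∀ j i → x j i ≤ c)
  block-bounded-above x = proj₁ outer , λ j i →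
    ≤-trans (proj₂ (bounded-above (x j)) i) (proj₂ outer j)
    where outer = bounded-above (λ j → proj₁ (bounded-above (x j)))

  block-bounded-below : ∀ {n} {b : Fin n → ℕ} (x : BlockVec b) → ∃[ c ] (∀ j i → c ≤ x j i)
  block-bounded-below x = proj₁ outer , λ j i →
    ≤-trans (proj₂ outer j) (proj₂ (bounded-below (x j)) i)
    where outer = bounded-below (λ j → proj₁ (bounded-below (x j)))

  average-≤ : ∀ {n} {p x : Vec n} {c} → (∀ k → 0# ≤ p k) → sum p ≈ 1# →
              (∀ k → x k ≤ c) → sum (λ k → p k * x k) ≤ c
  average-≤ {n} {p} {x} {c} 0≤p Σp≈1 x≤c = ≤-respʳ-≈
    (trans (sym (*-distribʳ-sum {n} c p)) (trans (*-congʳ Σp≈1) (*-identityˡ c)))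
    (sum-mono-≤ {n} λ k → *-monoʳ-≤ (0≤p k) (x≤c k))

  average-const : ∀ {n} {p : Vec n} c → sum p ≈ 1# → sum (λ k → p k * c) ≈ c
  average-const {n} {p} c Σp≈1 =
    trans (sym (*-distribʳ-sum {n} c p)) (trans (*-congʳ Σp≈1) (*-identityˡ c))

  IsStochastic : ∀ {m n} → Matrix m n → Set
  IsStochastic P = (∀ i k → 0# ≤ P i k) × (∀ i → sum (P i) ≈ 1#)

  module Discounting {γ : Carrier} (0≤γ : 0# ≤ γ) (γ<1 : γ <ᴿ 1#) where

    x≤γx⇒x≤0 : ∀ {x} → x ≤ γ * x → x ≤ 0#
    x≤γx⇒x≤0 {x} x≤γx with <-or-≥ 0# x
    ... | inj₂ x≤0 = x≤0
    ... | inj₁ 0<x = contradiction [1-γ]x≤0 (<⇒≱ (*-positive 0<1-γ 0<x))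
      where
      0<1-γ : 0# <ᴿ 1# - γ
      0<1-γ = x≤y⇒0≤y-x (proj₁ γ<1) , λ 0≈1-γ → proj₂ γ<1 (sym (x-y≈0⇒x≈y (sym 0≈1-γ)))
      [1-γ]x≤0 : (1# - γ) * x ≤ 0#
      [1-γ]x≤0 = ≤-resp₂-≈
        (solve 2 (λ g x → x :- g :* x := (:1 :- g) :* x) refl γ x)
        (-‿inverseʳ (γ * x)) (+-monoˡ-≤ (- (γ * x)) x≤γx)

    -- The contraction principle: at an index where `x` is maximal, the bound `c` may be `x m`
    -- itself, which gives `x m ≤ γ * x m`. It does the work of a maximum norm throughout.
    discount-≤0 : ∀ {n} {x : Vec n} → (∀ i {c} → (∀ k → x k ≤ c) → x i ≤ γ * c) → ∀ i → x i ≤ 0#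
    discount-≤0 {suc n} {x} x≤γc i with argmax x
    ... | m , x≤xₘ = ≤-trans (x≤xₘ i) (x≤γx⇒x≤0 (x≤γc m x≤xₘ))

    -- Row `j` of I - γP, where `p` is row `j` of P. The index is kept apart from `p` because a
    -- block has several rows for the same state.
    discountedRow : ∀ {n} → Fin n → Vec n → Vec n
    discountedRow {n} j p k = scalarMatrix n 1# j k - γ * p k

    discountedRow-sum : ∀ {n} j (p x : Vec n) →
      sum (λ k → discountedRow j p k * x k) ≈ x j - γ * sum (λ k → p k * x k)
    discountedRow-sum {n} j p x = begin
      sum (λ k → (scalarMatrix n 1# j k - γ * p k) * x k)
        ≈⟨ sum-cong-≋ {n} (λ k → solve 4 (λ d g p x → (d :- g :* p) :* x := d :* x :- g :* (p :* x))
                                     refl (scalarMatrix n 1# j k) γ (p k) (x k)) ⟩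
      sum (λ k → scalarMatrix n 1# j k * x k - γ * (p k * x k))
        ≈⟨ sum-distrib-- {n} _ _ ⟩
      sum (λ k → scalarMatrix n 1# j k * x k) - sum (λ k → γ * (p k * x k))
        ≈⟨ +-cong (trans (scalarMatrix-·ᵛ 1# x j) (*-identityˡ _)) (-‿cong (sym (*-distribˡ-sum {n} γ _))) ⟩
      x j - γ * sum (λ k → p k * x k) ∎

    discountedRow-≤0 : ∀ {n} j {p : Vec n} → (∀ k → 0# ≤ p k) → ∀ k → j ≢ k → discountedRow j p k ≤ 0#
    discountedRow-≤0 j 0≤p k j≢k = ≤-respˡ-≈
      (sym (trans (+-congʳ (scalarMatrix-offDiagonal 1# j k j≢k)) (+-identityˡ _)))
      (0≤x⇒-x≤0 (*-nonNegative 0≤γ (0≤p k)))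

    discounted : ∀ {n} → Matrix n n → Matrix n n
    discounted P j = discountedRow j (P j)

    -- At an index where y is maximal and positive, y − γPy is positive as well.
    discounted-signs-≤0 : ∀ {n} {P Q : Matrix n n} → IsStochastic P → IsStochastic Q → ∀ y →
      (∀ i → (discounted P ·ᵛ y) i * (discounted Q ·ᵛ y) i ≤ 0#) → ∀ i → y i ≤ 0#
    discounted-signs-≤0 {n} {P} {Q} P-stochastic Q-stochastic y reversed = discount-≤0 y≤γc
      where
      y≤γc : ∀ i {c} → (∀ k → y k ≤ c) → y i ≤ γ * c
      y≤γc i {c} y≤c with <-or-≥ (γ * c) (y i)
      ... | inj₂ yᵢ≤γc = yᵢ≤γc
      ... | inj₁ γc<yᵢ = contradiction (reversed i)
              (<⇒≱ (*-positive (positive P-stochastic) (positive Q-stochastic)))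
        where
        positive : ∀ {R} → IsStochastic R → 0# <ᴿ (discounted R ·ᵛ y) i
        positive {R} (0≤R , ΣR≈1) = <-respʳ-≈ (sym (discountedRow-sum i (R i) y))
          (<-≤-trans 0<yᵢ-γc (+-monoʳ-≤ (y i) (-‿anti-≤ (*-monoʳ-≤ 0≤γ (average-≤ (0≤R i) (ΣR≈1 i) y≤c)))))
          where
          0<yᵢ-γc : 0# <ᴿ y i - γ * c
          0<yᵢ-γc = x≤y⇒0≤y-x (proj₁ γc<yᵢ) , λ 0≈ → proj₂ γc<yᵢ (sym (x-y≈0⇒x≈y (sym 0≈)))

    -- The one-sided bound is applied to `y` and to its negative; negation leaves the products
    -- unchanged.
    discounted-signs : ∀ {n} {P Q : Matrix n n} → IsStochastic P → IsStochastic Q → ∀ y →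
      (∀ i → (discounted P ·ᵛ y) i * (discounted Q ·ᵛ y) i ≤ 0#) → ∀ i → y i ≈ 0#
    discounted-signs {n} {P} {Q} P-stochastic Q-stochastic y reversed i = ≤-antisym
      (discounted-signs-≤0 P-stochastic Q-stochastic y reversed i)
      (≤-respʳ-≈ (-‿involutive _) (x≤0⇒0≤-x
        (discounted-signs-≤0 P-stochastic Q-stochastic (-_ ∘ y) reversed′ i)))
      where
      reversed′ : ∀ i → (discounted P ·ᵛ (-_ ∘ y)) i * (discounted Q ·ᵛ (-_ ∘ y)) i ≤ 0#
      reversed′ i = ≤-respˡ-≈ (begin
        (discounted P ·ᵛ y) i * (discounted Q ·ᵛ y) i
          ≈⟨ solve 2 (λ a b → a :* b := (:- a) :* (:- b)) refl _ _ ⟩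
        - (discounted P ·ᵛ y) i * - (discounted Q ·ᵛ y) i
          ≈⟨ *-cong (·ᵛ-neg (discounted P) y i) (·ᵛ-neg (discounted Q) y i) ⟨
        (discounted P ·ᵛ (-_ ∘ y)) i * (discounted Q ·ᵛ (-_ ∘ y)) i ∎) (reversed i)

    -- The sign condition with both matrices equal, for the difference of `x` and `y`, whose image
    -- is zero.
    discounted-injective : ∀ {n} {P : Matrix n n} → IsStochastic P → ∀ {x y} →
      (∀ i → (discounted P ·ᵛ x) i ≈ (discounted P ·ᵛ y) i) → ∀ i → x i ≈ y i
    discounted-injective {n} {P} P-stochastic {x} {y} Px≈Py i = x-y≈0⇒x≈y
      (discounted-signs P-stochastic P-stochastic (λ i → x i - y i) (x≈0⇒x*y≤0 ∘ image≈0) i)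
      where
      image≈0 : ∀ i → (discounted P ·ᵛ λ i → x i - y i) i ≈ 0#
      image≈0 i = trans (·ᵛ-distribˡ-- (discounted P) x y i) (trans (+-congʳ (Px≈Py i)) (-‿inverseʳ _))

  -- Values of discounted games

  abstract

    optimum : ∀ p {k} .{{_ : NonZero k}} (f : Vec k) → ∃[ x ] IsOptimum p f x
    optimum maxPlayer {suc k} f with argmax f
    ... | m , f≤fₘ = f m , f≤fₘ , m , refl
    optimum minPlayer {suc k} f with argmin f
    ... | m , fₘ≤f = f m , fₘ≤f , m , refl

  optimum-attained : ∀ p {k} {f : Vec k} {x} → IsOptimum p f x → ∃[ i ] x ≈ f i
  optimum-attained maxPlayer = proj₂
  optimum-attained minPlayer = proj₂

  optimum-resp-≈ : ∀ p {k} {f : Vec k} {x y} → x ≈ y → IsOptimum p f x → IsOptimum p f y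
  optimum-resp-≈ maxPlayer x≈y (f≤x , i , x≈fᵢ) =
    (λ i → ≤-respʳ-≈ x≈y (f≤x i)) , i , trans (sym x≈y) x≈fᵢ
  optimum-resp-≈ minPlayer x≈y (x≤f , i , x≈fᵢ) =
    (λ i → ≤-respˡ-≈ x≈y (x≤f i)) , i , trans (sym x≈y) x≈fᵢ

  -- For `maxPlayer` the comparison takes place at the action attaining `x`, for `minPlayer` at the
  -- one attaining `y`.
  optimum-mono : ∀ p {k} {f g : Vec k} {c x y} → (∀ i → f i ≤ g i + c) →
                 IsOptimum p f x → IsOptimum p g y → x ≤ y + c
  optimum-mono maxPlayer {c = c} f≤g+c (_ , i , x≈fᵢ) (g≤y , _) =
    ≤-respˡ-≈ (sym x≈fᵢ) (≤-trans (f≤g+c i) (+-monoˡ-≤ c (g≤y i)))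
  optimum-mono minPlayer {c = c} f≤g+c (x≤f , _) (_ , i , y≈gᵢ) =
    ≤-trans (x≤f i) (≤-respʳ-≈ (+-congʳ (sym y≈gᵢ)) (f≤g+c i))

  module _ {n} {a : Fin n → ℕ} (G : Game a) where

    open Game G
    open Discounting 0≤γ γ<1

    -- Transition probabilities sum to one, so a uniform shift by `c` survives averaging and is then
    -- discounted.
    actionValue-mono : ∀ {u v c} → (∀ k → u k ≤ v k + c) →
                       ∀ j i → actionValue u j i ≤ actionValue v j i + γ * c
    actionValue-mono {u} {v} {c} u≤v+c j i = ≤-respʳ-≈ (begin
      reward j i + γ * (p ·ᵛ λ k → v k + c) i    ≈⟨ +-congˡ (*-congˡ (·ᵛ-distribˡ-+ p v (const c) i)) ⟩
      reward j i + γ * ((p ·ᵛ v) i + (p ·ᵛ const c) i)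
        ≈⟨ +-congˡ (*-congˡ (+-congˡ (average-const {n} c (transition-sum j i)))) ⟩
      reward j i + γ * ((p ·ᵛ v) i + c)
        ≈⟨ solve 4 (λ r g x c → r :+ g :* (x :+ c) := r :+ g :* x :+ g :* c) refl _ _ _ _ ⟩
      reward j i + γ * (p ·ᵛ v) i + γ * c ∎)
      (+-monoʳ-≤ _ (*-monoʳ-≤ 0≤γ (sum-mono-≤ {n} λ k → *-monoʳ-≤ (transition≥0 j i k) (u≤v+c k))))
      where p = transition j

    actionValue-const : ∀ c j i → actionValue (const c) j i ≈ reward j i + γ * c
    actionValue-const c j i = +-congˡ (*-congˡ (average-const {n} c (transition-sum j i)))

    -- With T the Bellman operator, these are u ≤ Tu and Tu ≤ u. Letting `x` be any optimum makes a
    -- value an instance of both at once.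
    IsSubsolution IsSupersolution : Vec n → Set
    IsSubsolution   u = ∀ j → ∃[ x ] (IsOptimum (owner j) (actionValue u j) x × u j ≤ x)
    IsSupersolution u = ∀ j → ∃[ x ] (IsOptimum (owner j) (actionValue u j) x × x ≤ u j)

    -- If u ≤ v + c, then u ≤ Tu ≤ Tv + γc ≤ v + γc, so the contraction principle applies to u - v.
    comparison : ∀ {u v} → IsSubsolution u → IsSupersolution v → ∀ j → u j ≤ v j
    comparison {u} {v} u-sub v-super j = 0≤y-x⇒x≤y (≤-respʳ-≈
      (solve 2 (λ u v → :- (u :- v) := v :- u) refl (u j) (v j))
      (x≤0⇒0≤-x (discount-≤0 difference j)))
      where
      difference : ∀ i {c} → (∀ k → u k - v k ≤ c) → u i - v i ≤ γ * c
      difference i {c} u-v≤c with u-sub i | v-super i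
      ... | x , x-opt , u≤x | y , y-opt , y≤v = ≤-respʳ-≈
        (solve 2 (λ v c → v :+ c :- v := c) refl (v i) (γ * c))
        (+-monoˡ-≤ (- v i) (≤-trans u≤x (≤-trans
          (optimum-mono (owner i) (actionValue-mono u≤v+c i) x-opt y-opt)
          (+-monoˡ-≤ (γ * c) y≤v))))
        where
        u≤v+c : ∀ k → u k ≤ v k + c
        u≤v+c k = ≤-resp₂-≈ (solve 2 (λ u v → u :- v :+ v := u) refl (u k) (v k)) (+-comm c (v k))
                    (+-monoˡ-≤ (v k) (u-v≤c k))

    value-unique : ∀ {u v} → IsValue G u → IsValue G v → ∀ j → u j ≈ v j
    value-unique u-value v-value j = ≤-antisym
      (comparison (λ j → _ , u-value j , ≤-refl) (λ j → _ , v-value j , ≤-refl) j)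
      (comparison (λ j → _ , v-value j , ≤-refl) (λ j → _ , u-value j , ≤-refl) j)

    bellman : Vec n → Vec n
    bellman u j = proj₁ (optimum (owner j) {{hasAction j}} (actionValue u j))

    bellman-optimum : ∀ u j → IsOptimum (owner j) (actionValue u j) (bellman u j)
    bellman-optimum u j = proj₂ (optimum (owner j) {{hasAction j}} (actionValue u j))

    -- Monotonicity of the Bellman operator: the shifted comparison with shift zero.
    optimum-≤bellman : ∀ {u v j x} → IsOptimum (owner j) (actionValue u j) x →
                       (∀ k → u k ≤ v k) → x ≤ bellman v j
    optimum-≤bellman {u} {v} {j} x-opt u≤v = ≤-respʳ-≈ (trans (+-congˡ (zeroʳ γ)) (+-identityʳ _))
      (optimum-mono (owner j)
        (actionValue-mono (λ k → ≤-respʳ-≈ (sym (+-identityʳ _)) (u≤v k)) j)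
        x-opt (bellman-optimum v j))

    abstract

      -- x ↦ r + γx has the fixed point r / (1 − γ).
      fixedPoint : ∀ r → ∃[ x ] r + γ * x ≈ x
      fixedPoint r with inverse (1# - γ) (λ 1-γ≈0 → proj₂ γ<1 (sym (x-y≈0⇒x≈y 1-γ≈0)))
      ... | d , [1-γ]d≈1 = r * d , (begin
        r + γ * (r * d)                    ≈⟨ +-congʳ (trans (sym (*-identityʳ r)) (*-congˡ (sym [1-γ]d≈1))) ⟩
        r * ((1# - γ) * d) + γ * (r * d)   ≈⟨ solve 3 (λ r g d → r :* ((:1 :- g) :* d) :+ g :* (r :* d)
                                                               := r :* d) refl r γ d ⟩
        r * d                              ∎)

    bellman-attained : ∀ u j → ∃[ i ] bellman u j ≈ actionValue u j i
    bellman-attained u j = optimum-attained (owner j) (bellman-optimum u j)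

    -- At a constant vector every action value is at least r + γc = c. Such constants make the set
    -- of subsolutions nonempty; dually, constant supersolutions bound it above.
    constant-isSubsolution : ∀ {r c} → (∀ j i → r ≤ reward j i) → r + γ * c ≈ c → IsSubsolution (const c)
    constant-isSubsolution {r} {c} r≤ r+γc≈c j = bellman (const c) j , bellman-optimum (const c) j , c≤
      where
      i = proj₁ (bellman-attained (const c) j)
      c≤ : c ≤ bellman (const c) j
      c≤ = ≤-resp₂-≈ r+γc≈c
        (sym (trans (proj₂ (bellman-attained (const c) j)) (actionValue-const c j i)))
        (+-monoˡ-≤ (γ * c) (r≤ j i))

    constant-isSupersolution : ∀ {r c} → (∀ j i → reward j i ≤ r) → r + γ * c ≈ c → IsSupersolution (const c)
    constant-isSupersolution {r} {c} ≤r r+γc≈c j = bellman (const c) j , bellman-optimum (const c) j , ≤c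
      where
      i = proj₁ (bellman-attained (const c) j)
      ≤c : bellman (const c) j ≤ c
      ≤c = ≤-resp₂-≈
        (sym (trans (proj₂ (bellman-attained (const c) j)) (actionValue-const c j i))) r+γc≈c
        (+-monoˡ-≤ (γ * c) (≤r j i))

    constantSubsolution : ∃[ c ] IsSubsolution (const c)
    constantSubsolution =
      proj₁ c , constant-isSubsolution (proj₂ (block-bounded-below reward)) (proj₂ c)
      where c = fixedPoint (proj₁ (block-bounded-below reward))

    constantSupersolution : ∃[ c ] IsSupersolution (const c)
    constantSupersolution =
      proj₁ c , constant-isSupersolution (proj₂ (block-bounded-above reward)) (proj₂ c)
      where c = fixedPoint (proj₁ (block-bounded-above reward))

    abstract

      -- The pointwise supremum of the subsolutions, as in the Knaster–Tarski theorem.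
      value-exists : ∃[ v ] IsValue G v
      value-exists = v , λ j → optimum-resp-≈ (owner j) (≤-antisym (bellman≤v j) (v≤bellman j)) (bellman-optimum v j)
        where
        Attained : Fin n → Carrier → Set
        Attained j x = ∃[ u ] (IsSubsolution u × u j ≈ x)
        supremum : ∀ j → ∃[ s ] (IsUpperBound (Attained j) s × (∀ b → IsUpperBound (Attained j) b → s ≤ b))
        supremum j = complete (Attained j)
          (_ , _ , proj₂ constantSubsolution , refl)
          (_ , λ { x (u , u-sub , uⱼ≈x) → ≤-respˡ-≈ uⱼ≈x (comparison u-sub (proj₂ constantSupersolution) j) })
        v : Vec n
        v j = proj₁ (supremum j)
        sub≤v : ∀ {u} → IsSubsolution u → ∀ j → u j ≤ v j
        sub≤v u-sub j = proj₁ (proj₂ (supremum j)) _ (_ , u-sub , refl)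
        sub≤bellman : ∀ {u} → IsSubsolution u → ∀ j → u j ≤ bellman v j
        sub≤bellman u-sub j = let x , x-opt , u≤x = u-sub j in
          ≤-trans u≤x (optimum-≤bellman x-opt (sub≤v u-sub))
        v≤bellman : ∀ j → v j ≤ bellman v j
        v≤bellman j = proj₂ (proj₂ (supremum j)) _
          λ { x (u , u-sub , uⱼ≈x) → ≤-respˡ-≈ uⱼ≈x (sub≤bellman u-sub j) }
        -- Since v ≤ Tv, monotonicity gives Tv ≤ T(Tv): `bellman v` is itself a subsolution and lies
        -- below the supremum.
        bellman≤v : ∀ j → bellman v j ≤ v j
        bellman≤v = sub≤v λ j → _ , bellman-optimum (bellman v) j , optimum-≤bellman (bellman-optimum v j) v≤bellman

  -- The formulation as a GLCP

  product-zero⁺ : ∀ {n} (f : Vec n) i → f i ≈ 0# → product f ≈ 0#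
  product-zero⁺ f zero    f₀≈0 = trans (*-congʳ f₀≈0) (zeroˡ _)
  product-zero⁺ f (suc i) fᵢ≈0 = trans (*-congˡ (product-zero⁺ (f ∘ suc) i fᵢ≈0)) (zeroʳ _)

  product-zero⁻ : ∀ {n} (f : Vec n) → product f ≈ 0# → ∃[ i ] f i ≈ 0#
  product-zero⁻ {zero}  f 1≈0 = contradiction (sym 1≈0) 0≉1
  product-zero⁻ {suc n} f Πf≈0 with x*y≈0⇒x≈0∨y≈0 Πf≈0
  ... | inj₁ f₀≈0 = zero , f₀≈0
  ... | inj₂ Πf≈0′ with product-zero⁻ (f ∘ suc) Πf≈0′
  ...   | i , fᵢ≈0 = suc i , fᵢ≈0

  ·ᵛ-basis : ∀ {m n} (A : Matrix m n) i k → (A ·ᵛ λ j → scalarMatrix n 1# j k) i ≈ A i k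
  ·ᵛ-basis {n = n} A i k = begin
    sum (λ j → A i j * scalarMatrix n 1# j k)
      ≈⟨ sum-support _ k (λ j k≢j → trans
           (*-congˡ (scalarMatrix-offDiagonal 1# j k (k≢j ∘ ≡.sym))) (zeroʳ _)) ⟩
    A i k * scalarMatrix n 1# k k
      ≈⟨ trans (*-congˡ (scalarMatrix-diagonal 1# k)) (*-identityʳ _) ⟩
    A i k ∎

  -- Inverses of discounted stochastic matrices

  module _ {γ : Carrier} (0≤γ : 0# ≤ γ) (γ<1 : γ <ᴿ 1#)
           {n} {P : Matrix n n} (P-stochastic : IsStochastic P) where

    open Discounting 0≤γ γ<1

    -- Inverse positivity of the M-matrix I - γP: if -y ≤ c, then y ≥ γPy ≥ -γc, and the contraction
    -- principle applies to -y.
    discounted-nonNegative : ∀ {y} → (∀ i → 0# ≤ (discounted P ·ᵛ y) i) → ∀ i → 0# ≤ y i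
    discounted-nonNegative {y} 0≤Xy i = ≤-respʳ-≈ (-‿involutive _) (x≤0⇒0≤-x (discount-≤0 -y≤γc i))
      where
      -y≤γc : ∀ i {c} → (∀ k → - y k ≤ c) → - y i ≤ γ * c
      -y≤γc i {c} -y≤c = ≤-resp₂-≈ (+-identityˡ _)
        (solve 3 (λ y g c → y :- g :* (:- c) :+ (:- y) := g :* c) refl (y i) γ c)
        (+-monoˡ-≤ (- y i) (≤-trans (≤-respʳ-≈ (discountedRow-sum i (P i) y) (0≤Xy i))
          (+-monoʳ-≤ (y i) (-‿anti-≤ (*-monoʳ-≤ 0≤γ -c≤Py)))))
        where
        -c≤Py : - c ≤ (P ·ᵛ y) i
        -c≤Py = ≤-respʳ-≈ (trans (-‿cong (·ᵛ-neg P y i)) (-‿involutive _))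
          (-‿anti-≤ (average-≤ {n} (proj₁ P-stochastic i) (proj₂ P-stochastic i) -y≤c))

    -- The value of a game with a single action per state.
    discounted-solvable : ∀ (r : Vec n) → ∃[ v ] (∀ i → (discounted P ·ᵛ v) i ≈ r i)
    discounted-solvable r = v , λ i → begin
      (discounted P ·ᵛ v) i                        ≈⟨ discountedRow-sum i (P i) v ⟩
      v i - γ * (P ·ᵛ v) i                         ≈⟨ +-congʳ (proj₂ (proj₂ (proj₂ (value-exists G) i))) ⟩
      r i + γ * (P ·ᵛ v) i - γ * (P ·ᵛ v) i        ≈⟨ solve 2 (λ r x → r :+ x :- x := r) refl _ _ ⟩
      r i                                          ∎
      where
      G : Game {n} (const 1)
      G = record
        { hasAction      = λ _ → _
        ; owner          = λ _ → maxPlayer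
        ; reward         = λ j _ → r j
        ; transition     = λ j _ → P j
        ; transition≥0   = λ j _ → proj₁ P-stochastic j
        ; transition-sum = λ j _ → proj₂ P-stochastic j
        ; γ              = γ
        ; 0≤γ            = 0≤γ
        ; γ<1            = γ<1
        }
      v : Vec n
      v = proj₁ (value-exists G)

    abstract

      discounted⁻¹ : Matrix n n
      discounted⁻¹ i k = proj₁ (discounted-solvable λ j → scalarMatrix n 1# j k) i

      discounted-column : ∀ k i → (discounted P ·ᵛ λ j → discounted⁻¹ j k) i ≈ scalarMatrix n 1# i k
      discounted-column k = proj₂ (discounted-solvable λ j → scalarMatrix n 1# j k)

    discounted⁻¹-nonNegative : ∀ i k → 0# ≤ discounted⁻¹ i k
    discounted⁻¹-nonNegative i k =
      discounted-nonNegative (λ j → ≤-respʳ-≈ (sym (discounted-column k j)) (0≤δ j)) i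
      where
      0≤δ : ∀ j → 0# ≤ scalarMatrix n 1# j k
      0≤δ j with j ≟ k
      ... | yes _ = 0≤1
      ... | no _  = ≤-refl

    discounted-inverseˡ : ∀ x i → (discounted P ·ᵛ (discounted⁻¹ ·ᵛ x)) i ≈ x i
    discounted-inverseˡ x i = begin
      (discounted P ·ᵛ (discounted⁻¹ ·ᵛ x)) i   ≈⟨ ·ᵛ-assoc (discounted P) discounted⁻¹ x i ⟨
      ((discounted P · discounted⁻¹) ·ᵛ x) i    ≈⟨ sum-cong-≋ {n} (λ k → *-congʳ (discounted-column k i)) ⟩
      (scalarMatrix n 1# ·ᵛ x) i                ≈⟨ trans (scalarMatrix-·ᵛ 1# x i) (*-identityˡ _) ⟩
      x i                                       ∎

    -- The right inverse is also a left inverse because I - γP is injective and both sides have the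
    -- same image.
    discounted-inverseʳ : ∀ x i → (discounted⁻¹ ·ᵛ (discounted P ·ᵛ x)) i ≈ x i
    discounted-inverseʳ x =
      discounted-injective P-stochastic (discounted-inverseˡ (discounted P ·ᵛ x))

    discounted⁻¹·discounted : ∀ i k → (discounted⁻¹ · discounted P) i k ≈ scalarMatrix n 1# i k
    discounted⁻¹·discounted i k = begin
      (discounted⁻¹ ·ᵛ λ j → discounted P j k) i
        ≈⟨ ·ᵛ-cong discounted⁻¹ (λ j → ·ᵛ-basis (discounted P) j k) i ⟨
      (discounted⁻¹ ·ᵛ (discounted P ·ᵛ λ j → scalarMatrix n 1# j k)) i
        ≈⟨ discounted-inverseʳ _ i ⟩
      scalarMatrix n 1# i k ∎

    -- r = (X⁻¹)ᵀ 𝟏 solves Xᵀ r = 𝟏.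
    discounted-columnSums : ∀ k → sum (λ j → discounted P j k * sum λ i → discounted⁻¹ i j) ≈ 1#
    discounted-columnSums k = begin
      sum {n} (λ j → X j k * sum {n} (λ i → C i j))     ≈⟨ sum-cong-≋ {n} (λ j → *-distribˡ-sum {n} (X j k) _) ⟩
      sum {n} (λ j → sum {n} (λ i → X j k * C i j))     ≈⟨ ∑-comm {n} {n} _ ⟩
      sum {n} (λ i → sum {n} (λ j → X j k * C i j))     ≈⟨ sum-cong-≋ {n} (λ i → sum-cong-≋ {n} λ j → *-comm (X j k) (C i j)) ⟩
      sum {n} (λ i → (C · X) i k)                       ≈⟨ sum-cong-≋ {n} (λ i → discounted⁻¹·discounted i k) ⟩
      sum {n} (λ i → scalarMatrix n 1# i k)             ≈⟨ sum-support {n} _ k (λ i k≢i → scalarMatrix-offDiagonal 1# i k (k≢i ∘ ≡.sym)) ⟩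
      scalarMatrix n 1# k k                             ≈⟨ scalarMatrix-diagonal 1# k ⟩
      1#                                                ∎
      where
      X = discounted P
      C = discounted⁻¹

    -- Substituting x = (I - γP)y turns the products into those of `discounted-signs`, so y and with
    -- it x vanishes.
    product-reversesNoSign : ∀ {Q} → IsStochastic Q → ReversesNoSign (discounted Q · discounted⁻¹)
    product-reversesNoSign {Q} Q-stochastic x reversed i = begin
      x i                                       ≈⟨ discounted-inverseˡ x i ⟨
      (discounted P ·ᵛ (discounted⁻¹ ·ᵛ x)) i   ≈⟨ sum-zero {n} (λ j → trans (*-congˡ (y≈0 j)) (zeroʳ _)) ⟩
      0#                                        ∎
      where
      y≈0 : ∀ j → (discounted⁻¹ ·ᵛ x) j ≈ 0#
      y≈0 = discounted-signs P-stochastic Q-stochastic (discounted⁻¹ ·ᵛ x) λ j → ≤-respˡ-≈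
        (*-cong (sym (discounted-inverseˡ x j)) (·ᵛ-assoc (discounted Q) discounted⁻¹ x j)) (reversed j)

  -- Signature matrices and conjugation

  module Signature {n} (σ : Vec n) (σσ≈1 : ∀ j → σ j * σ j ≈ 1#) where

    signature : Matrix n n
    signature i j = scalarMatrix n (σ i) i j

    module _ {b : Fin n → ℕ} where

      signed-entry : ∀ (q : BlockVec b) j i → signed signature q j i ≈ σ j * q j i
      signed-entry q j i = trans (scalarMatrix-·ᵛ (signature j j) (q j) i)
                                 (*-congʳ (scalarMatrix-diagonal (σ j) j))

      conjugate-entry : ∀ (M : BlockMatrix b) j i k → conjugate signature M j i k ≈ σ j * M j i k * σ k
      conjugate-entry M j i k = begin
        conjugate signature M j i k
          ≈⟨ sum-support {n} _ k (λ m k≢m → trans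
               (*-congˡ (scalarMatrix-offDiagonal (σ m) m k (k≢m ∘ ≡.sym))) (zeroʳ _)) ⟩
        (scalarMatrix (b j) (signature j j) ·ᵛ (λ l → M j l k)) i * signature k k
          ≈⟨ *-cong (scalarMatrix-·ᵛ (signature j j) (λ l → M j l k) i) (scalarMatrix-diagonal (σ k) k) ⟩
        signature j j * M j i k * σ k
          ≈⟨ *-congʳ (*-congʳ (scalarMatrix-diagonal (σ j) j)) ⟩
        σ j * M j i k * σ k ∎

      conjugate-·ᵛ : ∀ (M : BlockMatrix b) z j i →
        (conjugate signature M j ·ᵛ z) i ≈ σ j * (M j ·ᵛ λ k → σ k * z k) i
      conjugate-·ᵛ M z j i = begin
        (conjugate signature M j ·ᵛ z) i
          ≈⟨ sum-cong-≋ {n} (λ k → trans (*-congʳ (conjugate-entry M j i k))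
               (solve 4 (λ s m t z → s :* m :* t :* z := s :* (m :* (t :* z))) refl (σ j) (M j i k) (σ k) (z k))) ⟩
        sum (λ k → σ j * (M j i k * (σ k * z k)))
          ≈⟨ *-distribˡ-sum {n} (σ j) _ ⟨
        σ j * (M j ·ᵛ λ k → σ k * z k) i ∎

      -- The outer sign moves from the image to the vector, so the products for `x` under SMS are
      -- those for Sx under M.
      conjugate-reversesNoSign : ∀ (M : BlockMatrix b) B → ReversesNoSign (representative M B) →
                                 ReversesNoSign (representative (conjugate signature M) B)
      conjugate-reversesNoSign M B M-rns x reversed i = begin
        x i               ≈⟨ trans (sym (*-identityˡ _)) (*-congʳ (sym (σσ≈1 i))) ⟩
        σ i * σ i * x i   ≈⟨ *-assoc _ _ _ ⟩
        σ i * (σ i * x i) ≈⟨ *-congˡ (M-rns (λ k → σ k * x k) reversed′ i) ⟩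
        σ i * 0#          ≈⟨ zeroʳ _ ⟩
        0#                ∎
        where
        reversed′ : ∀ i → (σ i * x i) * (representative M B ·ᵛ λ k → σ k * x k) i ≤ 0#
        reversed′ i = ≤-respˡ-≈ (trans (*-congˡ (conjugate-·ᵛ M x i (B i)))
          (solve 3 (λ x s m → x :* (s :* m) := s :* x :* m) refl _ _ _)) (reversed i)

  -- Optima in terms of signed slacks

  sign : Player → Carrier
  sign maxPlayer = 1#
  sign minPlayer = - 1#

  sign*sign : ∀ p → sign p * sign p ≈ 1#
  sign*sign maxPlayer = *-identityˡ 1#
  sign*sign minPlayer = trans (-1*x≈-x (- 1#)) (-‿involutive 1#)

  sign*sign*x : ∀ p x → sign p * (sign p * x) ≈ x
  sign*sign*x p x = trans (sym (*-assoc _ _ _)) (trans (*-congʳ (sign*sign p)) (*-identityˡ x))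

  sign*[x-y]≈0⇔x≈y : ∀ p {x y} → sign p * (x - y) ≈ 0# ⇔ x ≈ y
  sign*[x-y]≈0⇔x≈y p {x} {y} = mk⇔
    (λ s≈0 → x-y≈0⇒x≈y (trans (sym (sign*sign*x p (x - y))) (trans (*-congˡ s≈0) (zeroʳ _))))
    (λ x≈y → trans (*-congˡ (x≈y⇒x∙y⁻¹≈ε x≈y)) (zeroʳ _))

  -1*[x-y]≈y-x : ∀ x y → - 1# * (x - y) ≈ y - x
  -1*[x-y]≈y-x x y = trans (-1*x≈-x (x - y)) (solve 2 (λ x y → :- (x :- y) := y :- x) refl x y)

  -- A maximum lies above all entries and a minimum below; the sign orients the differences so that
  -- both cases become one complementarity condition.
  optimum⇒slack : ∀ p {k} {f : Vec k} {x} → IsOptimum p f x →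
    (∀ i → 0# ≤ sign p * (x - f i)) × (∃[ i ] sign p * (x - f i) ≈ 0#)
  optimum⇒slack maxPlayer (f≤x , i , x≈fᵢ) =
    (λ i → ≤-respʳ-≈ (sym (*-identityˡ _)) (x≤y⇒0≤y-x (f≤x i))) ,
    i , Equivalence.from (sign*[x-y]≈0⇔x≈y maxPlayer) x≈fᵢ
  optimum⇒slack minPlayer (x≤f , i , x≈fᵢ) =
    (λ i → ≤-respʳ-≈ (sym (-1*[x-y]≈y-x _ _)) (x≤y⇒0≤y-x (x≤f i))) ,
    i , Equivalence.from (sign*[x-y]≈0⇔x≈y minPlayer) x≈fᵢ

  slack⇒optimum : ∀ p {k} {f : Vec k} {x} → (∀ i → 0# ≤ sign p * (x - f i)) →
    ∃[ i ] sign p * (x - f i) ≈ 0# → IsOptimum p f x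
  slack⇒optimum maxPlayer 0≤s (i , sᵢ≈0) =
    (λ i → 0≤y-x⇒x≤y (≤-respʳ-≈ (*-identityˡ _) (0≤s i))) ,
    i , Equivalence.to (sign*[x-y]≈0⇔x≈y maxPlayer) sᵢ≈0
  slack⇒optimum minPlayer 0≤s (i , sᵢ≈0) =
    (λ i → 0≤y-x⇒x≤y (≤-respʳ-≈ (-1*[x-y]≈y-x _ _) (0≤s i))) ,
    i , Equivalence.to (sign*[x-y]≈0⇔x≈y minPlayer) sᵢ≈0

  -- Splitting off the default action

  lastAction : ∀ k → .{{NonZero k}} → Fin k
  lastAction (suc k) = fromℕ k

  -- Skipping the last index with `punchIn` matches the position at which `append` inserts `z`.
  otherAction : ∀ k → .{{_ : NonZero k}} → Fin (pred k) → Fin k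
  otherAction (suc k) = punchIn (fromℕ k)

  last-or-other : ∀ k .{{_ : NonZero k}} (i : Fin k) → i ≡ lastAction k ⊎ ∃[ i′ ] i ≡ otherAction k i′
  last-or-other (suc k) i with fromℕ k ≟ i
  ... | yes last≡i = inj₁ (≡.sym last≡i)
  ... | no last≢i  = inj₂ (punchOut last≢i , ≡.sym (punchIn-punchOut last≢i))

  -- The GLCP of a given game

  module Formulation {n} {a : Fin n → ℕ} (G : Game a) where

    open Game G
    open Discounting 0≤γ γ<1

    last : ∀ j → Fin (a j)
    last j = lastAction (a j) {{hasAction j}}

    other : ∀ j → Fin (pred (a j)) → Fin (a j)
    other j = otherAction (a j) {{hasAction j}}

    slack-last : ∀ w z j → slack G w z j (last j) ≡ z j
    slack-last w z j = append-last (a j) {{hasAction j}}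
      where
      append-last : ∀ k .{{_ : NonZero k}} {x : Vec (pred k)} {y} → append G x y (lastAction k) ≡ y
      append-last (suc k) {x} {y} = insertAt-lookup x (fromℕ k) y

    slack-other : ∀ w z j i → slack G w z j (other j i) ≡ w j i
    slack-other w z j = append-other (a j) {{hasAction j}}
      where
      append-other : ∀ k .{{_ : NonZero k}} {x : Vec (pred k)} {y} i → append G x y (otherAction k i) ≡ x i
      append-other (suc k) {x} {y} i = insertAt-punchIn x (fromℕ k) y i

    by-actions : ∀ j {Q : Fin (a j) → Set} → Q (last j) → (∀ i → Q (other j i)) → ∀ i → Q i
    by-actions j {Q} Q-last Q-other i with last-or-other (a j) {{hasAction j}} i
    ... | inj₁ i≡last        = ≡.subst Q (≡.sym i≡last) Q-last
    ... | inj₂ (i′ , i≡other) = ≡.subst Q (≡.sym i≡other) (Q-other i′)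

    P₀ : Matrix n n
    P₀ j = transition j (last j)

    P₀-stochastic : IsStochastic P₀
    P₀-stochastic = (λ j → transition≥0 j (last j)) , (λ j → transition-sum j (last j))

    X C : Matrix n n
    X = discounted P₀
    C = discounted⁻¹ 0≤γ γ<1 P₀-stochastic

    Y M : BlockMatrix (pred ∘ a)
    Y j i = discountedRow j (transition j (other j i))
    M j   = Y j · C

    r₀ : Vec n
    r₀ j = reward j (last j)

    -- The constant term left over when v = X⁻¹(Sz + r₀) is substituted into Yv - r.
    q : BlockVec (pred ∘ a)
    q j i = (M j ·ᵛ r₀) i - reward j (other j i)

    σ : Vec n
    σ j = sign (owner j)

    open Signature σ (sign*sign ∘ owner) public

    M·X : ∀ j i k → (M j · X) i k ≈ Y j i k
    M·X j i k = begin
      (M j · X) i k                             ≈⟨ ·ᵛ-assoc (Y j) C (λ m → X m k) i ⟩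
      (Y j ·ᵛ (C ·ᵛ λ m → X m k)) i             ≈⟨ ·ᵛ-cong (Y j) (λ l → discounted⁻¹·discounted 0≤γ γ<1 P₀-stochastic l k) i ⟩
      (Y j ·ᵛ λ l → scalarMatrix n 1# l k) i    ≈⟨ ·ᵛ-basis (Y j) i k ⟩
      Y j i k                                   ∎

    M-hiddenZ : IsHiddenZMatrix M
    -- With `s` zero the last condition is Xᵀr > 0, and the column sums of X⁻¹ as `r` make the left
    -- side the all-ones vector.
    M-hiddenZ = X , Y , (λ j → sum λ i → C i j) , (λ _ _ → 0#)
      , (λ j k → discountedRow-≤0 j (transition≥0 j (last j)) k)
      , (λ B j k → discountedRow-≤0 j (transition≥0 j (other j (B j))) k)
      , (λ j → sum-nonNegative {n} λ i → discounted⁻¹-nonNegative 0≤γ γ<1 P₀-stochastic i j)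
      , (λ _ _ → ≤-refl)
      , M·X
      , λ k → <-respʳ-≈ (sym (columnSum k)) (0≤1 , 0≉1)
      where
      columnSum : ∀ k → sum (λ j → X j k * sum λ i → C i j) + sum (λ j → sum λ i → Y j i k * 0#) ≈ 1#
      columnSum k = trans
        (+-cong (discounted-columnSums 0≤γ γ<1 P₀-stochastic k)
                (sum-zero {n} λ j → sum-zero {pred (a j)} λ i → zeroʳ _))
        (+-identityʳ 1#)

    M-reversesNoSign : ∀ B → ReversesNoSign (representative M B)
    M-reversesNoSign B = product-reversesNoSign 0≤γ γ<1 P₀-stochastic
      ((λ j → transition≥0 j (other j (B j))) , (λ j → transition-sum j (other j (B j))))

    M-blockP : IsBlockPMatrix M
    M-blockP B = reversesNoSign⇒IsPMatrix (representative M B) (M-reversesNoSign B)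

    conjugate-blockP : IsBlockPMatrix (conjugate signature M)
    conjugate-blockP B = reversesNoSign⇒IsPMatrix (representative (conjugate signature M) B)
      (conjugate-reversesNoSign M B (M-reversesNoSign B))

    slackAt : Vec n → BlockVec a
    slackAt v j i = σ j * (v j - actionValue v j i)

    slackAt-row : ∀ v j i → slackAt v j i ≈
      σ j * (sum (λ k → discountedRow j (transition j i) k * v k) - reward j i)
    slackAt-row v j i = *-congˡ (begin
      v j - (reward j i + γ * (transition j ·ᵛ v) i)
        ≈⟨ solve 3 (λ v r x → v :- (r :+ x) := v :- x :- r) refl _ _ _ ⟩
      v j - γ * (transition j ·ᵛ v) i - reward j i
        ≈⟨ +-congʳ (discountedRow-sum j (transition j i) v) ⟨
      sum (λ k → discountedRow j (transition j i) k * v k) - reward j i ∎)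

    slackAt-cong : ∀ {u v} → (∀ k → u k ≈ v k) → ∀ j i → slackAt u j i ≈ slackAt v j i
    slackAt-cong u≈v j i =
      *-congˡ (+-cong (u≈v j) (-‿cong (+-congˡ (*-congˡ (·ᵛ-cong (transition j) u≈v i)))))

    -- This is the hypothesis of `affine-slackAt` for z = `zAt v`; the two signs cancel.
    X-slackAt : ∀ v k → σ k * slackAt v k (last k) + r₀ k ≈ (X ·ᵛ v) k
    X-slackAt v k = begin
      σ k * slackAt v k (last k) + r₀ k
        ≈⟨ +-congʳ (*-congˡ (slackAt-row v k (last k))) ⟩
      σ k * (σ k * ((X ·ᵛ v) k - r₀ k)) + r₀ k
        ≈⟨ +-congʳ (sign*sign*x (owner k) _) ⟩
      (X ·ᵛ v) k - r₀ k + r₀ k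
        ≈⟨ solve 2 (λ x r → x :- r :+ r := x) refl _ _ ⟩
      (X ·ᵛ v) k ∎

    -- z determines v through Xv = Sz + r₀, and then Mz plus the constant term
    -- is the slack of the remaining actions.
    affine-slackAt : ∀ v z → (∀ k → σ k * z k + r₀ k ≈ (X ·ᵛ v) k) → ∀ j i →
      (conjugate signature M j ·ᵛ z) i + signed signature q j i ≈ slackAt v j (other j i)
    affine-slackAt v z Sz+r₀≈Xv j i = begin
      (conjugate signature M j ·ᵛ z) i + signed signature q j i
        ≈⟨ +-cong (conjugate-·ᵛ M z j i) (signed-entry q j i) ⟩
      σ j * (M j ·ᵛ Sz) i + σ j * ((M j ·ᵛ r₀) i - ρ)
        ≈⟨ solve 4 (λ s m r p → s :* m :+ s :* (r :- p) := s :* (m :+ r :- p)) refl _ _ _ _ ⟩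
      σ j * ((M j ·ᵛ Sz) i + (M j ·ᵛ r₀) i - ρ)
        ≈⟨ *-congˡ (+-congʳ (·ᵛ-distribˡ-+ (M j) Sz r₀ i)) ⟨
      σ j * ((M j ·ᵛ λ k → Sz k + r₀ k) i - ρ)
        ≈⟨ *-congˡ (+-congʳ (·ᵛ-cong (M j) Sz+r₀≈Xv i)) ⟩
      σ j * ((M j ·ᵛ (X ·ᵛ v)) i - ρ)
        ≈⟨ *-congˡ (+-congʳ (·ᵛ-assoc (Y j) C (X ·ᵛ v) i)) ⟩
      σ j * ((Y j ·ᵛ (C ·ᵛ (X ·ᵛ v))) i - ρ)
        ≈⟨ *-congˡ (+-congʳ (·ᵛ-cong (Y j) (discounted-inverseʳ 0≤γ γ<1 P₀-stochastic v) i)) ⟩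
      σ j * ((Y j ·ᵛ v) i - ρ)
        ≈⟨ slackAt-row v j (other j i) ⟨
      slackAt v j (other j i) ∎
      where
      Sz : Vec n
      Sz k = σ k * z k
      ρ = reward j (other j i)

    wAt : Vec n → BlockVec (pred ∘ a)
    wAt v j i = slackAt v j (other j i)

    zAt : Vec n → Vec n
    zAt v j = slackAt v j (last j)

    value⇒solution : ∀ {v} → IsValue G v →
      IsGLCPSolution (conjugate signature M) (signed signature q) (wAt v) (zAt v)
    value⇒solution {v} v-value = record
      { equation      = λ j i → trans
          (+-congʳ (sym (affine-slackAt v (zAt v) (X-slackAt v) j i)))
          (solve 2 (λ x y → x :+ y :- x := y) refl _ _)
      ; w-nonNegative = λ j i → proj₁ (slacks j) (other j i)
      ; z-nonNegative = λ j → proj₁ (slacks j) (last j)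
      -- An action attaining the optimum is either the default one, and then z vanishes, or another,
      -- and then a factor of the product does.
      ; complementary = λ j → let i , sᵢ≈0 = proj₂ (slacks j) in
          by-actions j {λ i → slackAt v j i ≈ 0# → zAt v j * _ ≈ 0#}
            (λ s≈0 → trans (*-congʳ s≈0) (zeroˡ _))
            (λ i s≈0 → trans (*-congˡ (product-zero⁺ (wAt v j) i s≈0)) (zeroʳ _))
            i sᵢ≈0
      }
      where
      slacks : ∀ j → (∀ i → 0# ≤ slackAt v j i) × (∃[ i ] slackAt v j i ≈ 0#)
      slacks j = optimum⇒slack (owner j) (v-value j)

    module _ {w z} (w,z-solution : IsGLCPSolution (conjugate signature M) (signed signature q) w z) where

      open IsGLCPSolution w,z-solution

      solutionValue : Vec n
      solutionValue = C ·ᵛ λ k → σ k * z k + r₀ k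

      X·solutionValue : ∀ k → σ k * z k + r₀ k ≈ (X ·ᵛ solutionValue) k
      X·solutionValue k = sym (discounted-inverseˡ 0≤γ γ<1 P₀-stochastic (λ k → σ k * z k + r₀ k) k)

      solution-z : ∀ j → z j ≈ zAt solutionValue j
      solution-z j = begin
        z j                                                          ≈⟨ sign*sign*x (owner j) (z j) ⟨
        σ j * (σ j * z j)                                            ≈⟨ *-congˡ (solve 2 (λ x r → x := x :+ r :- r) refl _ _) ⟩
        σ j * (σ j * z j + r₀ j - r₀ j)                              ≈⟨ *-congˡ (+-congʳ (X·solutionValue j)) ⟩
        σ j * ((X ·ᵛ solutionValue) j - r₀ j)                        ≈⟨ slackAt-row solutionValue j (last j) ⟨
        zAt solutionValue j                                          ∎

      solution-w : ∀ j i → w j i ≈ wAt solutionValue j i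
      solution-w j i = begin
        w j i
          ≈⟨ solve 2 (λ w x → w := x :+ (w :- x)) refl _ _ ⟩
        (conjugate signature M j ·ᵛ z) i + (w j i - (conjugate signature M j ·ᵛ z) i)
          ≈⟨ +-congˡ (equation j i) ⟩
        (conjugate signature M j ·ᵛ z) i + signed signature q j i
          ≈⟨ affine-slackAt solutionValue z X·solutionValue j i ⟩
        wAt solutionValue j i ∎

      -- All entries of `w` and `z` are slacks at `solutionValue`: nonnegativity gives the
      -- inequalities of an optimum, and complementarity an action attaining it.
      solution⇒value : IsValue G solutionValue
      solution⇒value j = slack⇒optimum (owner j)
        (by-actions j {λ i → 0# ≤ slackAt solutionValue j i}
          (≤-respʳ-≈ (solution-z j) (z-nonNegative j))
          (λ i → ≤-respʳ-≈ (solution-w j i) (w-nonNegative j i)))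
        ([ (λ zⱼ≈0 → last j , trans (sym (solution-z j)) zⱼ≈0)
         , (λ Πwⱼ≈0 → let i , wᵢ≈0 = product-zero⁻ (w j) Πwⱼ≈0 in
             other j i , trans (sym (solution-w j i)) wᵢ≈0)
         ]′ (x*y≈0⇒x≈0∨y≈0 (complementary j)))

    formulation : IsFormulation G (conjugate signature M) (signed signature q)
    formulation = wAt v , zAt v , value⇒solution v-value , unique , policies
      where
      v : Vec n
      v = proj₁ (value-exists G)
      v-value : IsValue G v
      v-value = proj₂ (value-exists G)
      -- Any solution consists of the slacks at a value of the game, and the value is unique.
      unique : ∀ w′ z′ → IsGLCPSolution (conjugate signature M) (signed signature q) w′ z′ →
               (∀ j i → w′ j i ≈ wAt v j i) × (∀ j → z′ j ≈ zAt v j)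
      unique w′ z′ solution =
        (λ j i → trans (solution-w solution j i) (slackAt-cong v′≈v j (other j i))) ,
        (λ j → trans (solution-z solution j) (slackAt-cong v′≈v j (last j)))
        where
        v′≈v : ∀ j → solutionValue solution j ≈ v j
        v′≈v = value-unique G (solution⇒value solution) v-value
      slack≈slackAt : ∀ j i → slack G (wAt v) (zAt v) j i ≈ slackAt v j i
      slack≈slackAt j = by-actions j {λ i → slack G (wAt v) (zAt v) j i ≈ slackAt v j i}
        (reflexive (slack-last (wAt v) (zAt v) j))
        (λ i → reflexive (slack-other (wAt v) (zAt v) j i))
      policies : ∀ π → IsOptimalPolicy G π ⇔ (∀ j → slack G (wAt v) (zAt v) j (π j) ≈ 0#)
      policies π = mk⇔
        -- Optimality comes with its own value `u`, which is identified with `v` by uniqueness.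
        (λ (u , u-value , u≈) j → trans (slack≈slackAt j (π j))
          (trans (slackAt-cong (value-unique G v-value u-value) j (π j))
                 (Equivalence.from (sign*[x-y]≈0⇔x≈y (owner j)) (u≈ j))))
        (λ slack≈0 → v , v-value , λ j →
          Equivalence.to (sign*[x-y]≈0⇔x≈y (owner j))
            (trans (sym (slack≈slackAt j (π j))) (slack≈0 j)))

    signature-isSignature : IsSignature signature
    signature-isSignature =
      (λ i j i≢j → scalarMatrix-offDiagonal (σ i) i j i≢j) ,
      (λ j → diagonal j (owner j) (scalarMatrix-diagonal (σ j) j))
      where
      diagonal : ∀ j p → signature j j ≈ sign p → signature j j ≈ 1# ⊎ signature j j ≈ - 1#
      diagonal j maxPlayer = inj₁
      diagonal j minPlayer = inj₂

theorem10p1 : (ℝ : Reals) → let open Theory ℝ in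
  ∀ {n : ℕ} (a : Fin n → ℕ) (G : Game a) →
  Σ[ M ∈ BlockMatrix (pred ∘ a) ] Σ[ S ∈ Matrix n n ] Σ[ q ∈ BlockVec (pred ∘ a) ]
    ( IsHiddenKMatrix M
    × IsSignature S
    × IsBlockPMatrix (conjugate S M)
    × IsFormulation G (conjugate S M) (signed S q) )
theorem10p1 ℝ a G =
  M , signature , q , (M-hiddenZ , M-blockP) , signature-isSignature , conjugate-blockP , formulation
  where open Formulation ℝ G
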